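{- Let $\mathbf{k}$ be a field of arbitrary characteristic. Let $f\in 2^{[m]*}$ be a nice function such that $K_f=\mathrm{supp}(f)$ is an abstract simplicial complex on vertex set $[m]$. Then $$|\mathrm{supp}(\mathcal{M}(f))|\leq \sum_{i=0}^h\sum_{a\in 2^{[m]}} \beta_{i, a}^{\mathbf{k}(K_f)},$$ where $h$ denotes the length of the minimal free resolution of $\mathbf{k}(K_f)$ and $\beta_{i,a}^{\mathbf{k}(K_f)}$ are the Betti numbers of $\mathbf{k}(K_f)$.
   Context: Let $m$ be a positive integer, $[m]=\{1,\dots,m\}$, and $2^{[m]}$ the power set of $[m]$. $2^{[m]*}$ is the set of all functions $f:2^{[m]}\to\mathbb{Z}/2\mathbb{Z}=\{0,1\}$. The support is $\mathrm{supp}(f)=f^{ -1}(1)\subseteq 2^{[m]}$. An abstract simplicial complex is a collection of subsets closed under taking subsets (including the empty set); it is on vertex set $[m]$ if the union of its members is $[m]$. $f$ is nice if $\mathrm{supp}(f)$ is an abstract simplicial complex. The $\mathbb{Z}/2\mathbb{Z}$-valued Möbius transform $\mathcal{M}:2^{[m]*}\to 2^{[m]*}$ is $\mathcal{M}(f)(a)=\sum_{b\subseteq a}f(b)$. Let $\mathbf{k}[\mathbf{v}]=\mathbf{k}[v_1,\dots,v_m]$ with its $\mathbb{N}^m$-grading. For $a\subseteq[m]$ put $\mathbf{v}^a=\prod_{i\in a}v_i$. The Stanley–Reisner face ring of a complex $K$ on $[m]$ is $\mathbf{k}(K)=\mathbf{k}[\mathbf{v}]/\langle \mathbf{v}^\tau\mid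 \tau\subseteq[m],\ \tau\notin K\rangle$. It has an $\mathbb{N}^m$-graded minimal free resolution $0\leftarrow \mathbf{k}(K)\leftarrow F_0\leftarrow F_1\leftarrow\cdots\leftarrow F_h\leftarrow 0$ over $\mathbf{k}[\mathbf{v}]$, with $F_i=\bigoplus_{\mathbf{a}\in\mathbb{N}^m}\mathbf{k}[\mathbf{v}](-\mathbf{a})^{\beta_{i,\mathbf{a}}^{\mathbf{k}(K)}}$, where $\mathbf{k}[\mathbf{v}](-\mathbf{a})$ is the free module generated in degree $\mathbf{a}$. For $a\in 2^{[m]}$, the Betti number $\beta_{i,a}^{\mathbf{k}(K)}$ means $\beta_{i,\mathbf{a}}^{\mathbf{k}(K)}$ with $\mathbf{a}\in\{0,1\}^m$ the indicator vector of $a$ (it is known that $\beta_{i,\mathbf{a}}^{\mathbf{k}(K)}=0$ for $\mathbf{a}\notin\{0,1\}^m$). -}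

module Defs where

open import Level using (0ℓ; _⊔_)
open import Algebra.Bundles using (CommutativeRing)
open import Algebra.Apartness.Bundles using (HeytingField; HeytingCommutativeRing)
open import Algebra.Module.Bundles using (Module)
open import Algebra.Module.Morphism.Structures using (module ModuleMorphisms)
open import Algebra.Module.Structures.Biased using (IsModuleFromLeft)
import Algebra.Construct.Pointwise as Pointwise
import Algebra.Properties.CommutativeSemigroup as CommutativeSemigroupProperties
import Algebra.Properties.Ring as RingProperties
open import Data.Bool.Base using (if_then_else_)
open import Data.Fin.Base using (Fin)
open import Data.Fin.Subset using (Subset; inside; outside; _∈_; _⊆_; ⁅_⁆)
  renaming (⊥ to ∅)
open import Data.Fin.Subset.Properties using (_⊆?_)
open import Data.List.Base as List
  using (List; []; _∷_; [_]; _++_; length; filter; foldr; sum; upTo; allFin; cartesianProductWith)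
open import Data.Nat.Base as ℕ using (ℕ; zero; suc)
import Data.List.Properties as List
import Data.Nat.Properties as ℕ
open import Data.Parity.Base using (Parity; 0ℙ; 1ℙ) renaming (_+_ to _+ℙ_)
import Data.Parity.Properties as Parity
open import Data.Product.Base using (_×_; _,_; ∃; ∃-syntax; map₁)
open import Data.Vec.Base as Vec using (Vec; []; _∷_; zipWith; replicate)
import Data.Vec.Properties as Vec
open import Function.Bundles using (_⇔_)
open import Function.Definitions using (Surjective)
open import Relation.Binary.PropositionalEquality as ≡ using (_≡_; _≢_)
open import Relation.Nullary using (Dec; does; yes; no; ¬_; contradiction)
open import Relation.Unary using (Pred)

-- Parity is the two-element ring ℤ/2ℤ.
PowerFunction : ℕ → Set
PowerFunction m = Subset m → Parity

supp : ∀ {m} → PowerFunction m → Pred (Subset m) 0ℓ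
supp f a = f a ≡ 1ℙ

subsets : ∀ m → List (Subset m)
subsets zero    = [ [] ]
subsets (suc m) = List.map (outside ∷_) (subsets m) ++ List.map (inside ∷_) (subsets m)

∣supp_∣ : ∀ {m} → PowerFunction m → ℕ
∣supp f ∣ = length (filter (λ a → f a Parity.≟ 1ℙ) (subsets _))

Möbius : ∀ {m} → PowerFunction m → PowerFunction m
Möbius f a = foldr _+ℙ_ 0ℙ (List.map f (filter (_⊆? a) (subsets _)))

record IsSimplicialComplex {m} (K : Pred (Subset m) 0ℓ) : Set where
  field
    ∅∈K         : K ∅
    down-closed : ∀ {a b} → b ⊆ a → K a → K b

IsOnVertexSet[m] : ∀ {m} → Pred (Subset m) 0ℓ → Set
IsOnVertexSet[m] {m} K = ∀ (i : Fin m) → ∃[ a ] K a × i ∈ a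

Nice : ∀ {m} → PowerFunction m → Set
Nice f = IsSimplicialComplex (supp f)

module Ideals {c ℓ} (R : CommutativeRing c ℓ) where
  open CommutativeRing R

  data ⟨_⟩ {s} (S : Pred Carrier s) : Pred Carrier (c ⊔ ℓ ⊔ s) where
    generator : ∀ {x} → S x → ⟨ S ⟩ x
    zero∈     : ⟨ S ⟩ 0#
    sum∈      : ∀ {x y} → ⟨ S ⟩ x → ⟨ S ⟩ y → ⟨ S ⟩ (x + y)
    multiple∈ : ∀ r {x} → ⟨ S ⟩ x → ⟨ S ⟩ (r * x)
    resp-≈    : ∀ {x y} → x ≈ y → ⟨ S ⟩ x → ⟨ S ⟩ y

  module _ {s} (S : Pred Carrier s) where
    open RingProperties ring
      using (-1*x≈-x; -‿distribʳ-*; -‿involutive; -‿+-comm)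
    open CommutativeSemigroupProperties +-commutativeSemigroup using (interchange)

    infix 4 _≈_mod
    record _≈_mod (x y : Carrier) : Set (c ⊔ ℓ ⊔ s) where
      constructor congruent
      field difference∈ : ⟨ S ⟩ (x - y)

    private
      negate : ∀ {x} → ⟨ S ⟩ x → ⟨ S ⟩ (- x)
      negate {x} p = resp-≈ (-1*x≈-x x) (multiple∈ (- 1#) p)

      telescope : ∀ x y z → (x - y) + (y - z) ≈ x - z
      telescope x y z = trans (+-assoc x (- y) (y - z))
        (+-congˡ (trans (sym (+-assoc (- y) y (- z)))
          (trans (+-congʳ (-‿inverseˡ y)) (+-identityˡ (- z)))))

      reflexive-mod : ∀ {x y} → x ≈ y → x ≈ y mod
      reflexive-mod {x} {y} x≈y =
        congruent (resp-≈ (sym (trans (+-congʳ x≈y) (-‿inverseʳ y))) zero∈)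

      sym-mod : ∀ {x y} → x ≈ y mod → y ≈ x mod
      sym-mod {x} {y} (congruent p) = congruent (resp-≈
        (trans (sym (-‿+-comm x (- y)))
          (trans (+-congˡ (-‿involutive y)) (+-comm (- x) y)))
        (negate p))

      trans-mod : ∀ {x y z} → x ≈ y mod → y ≈ z mod → x ≈ z mod
      trans-mod {x} {y} {z} (congruent p) (congruent q) =
        congruent (resp-≈ (telescope x y z) (sum∈ p q))

      +-cong-mod : ∀ {x y u v} → x ≈ y mod → u ≈ v mod → (x + u) ≈ (y + v) mod
      +-cong-mod {x} {y} {u} {v} (congruent p) (congruent q) = congruent (resp-≈
        (trans (interchange x (- y) u (- v)) (+-congˡ (-‿+-comm y v)))
        (sum∈ p q))

      -‿cong-mod : ∀ {x y} → x ≈ y mod → (- x) ≈ (- y) mod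
      -‿cong-mod {x} {y} (congruent p) =
        congruent (resp-≈ (sym (-‿+-comm x (- y))) (negate p))

      *-congʳ-mod : ∀ {x y} u → x ≈ y mod → (u * x) ≈ (u * y) mod
      *-congʳ-mod {x} {y} u (congruent p) = congruent (resp-≈
        (trans (distribˡ u x (- y)) (+-congˡ (sym (-‿distribʳ-* u y))))
        (multiple∈ u p))

      *-cong-mod : ∀ {x y u v} → x ≈ y mod → u ≈ v mod → (x * u) ≈ (y * v) mod
      *-cong-mod {x} {y} {u} {v} p q = trans-mod
        (trans-mod (reflexive-mod (*-comm x u))
          (trans-mod (*-congʳ-mod u p) (reflexive-mod (*-comm u y))))
        (*-congʳ-mod y q)

    quotientRing : CommutativeRing c (c ⊔ ℓ ⊔ s)
    quotientRing = record
      { Carrier = Carrier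
      ; _≈_ = _≈_mod
      ; _+_ = _+_
      ; _*_ = _*_
      ; -_  = -_
      ; 0#  = 0#
      ; 1#  = 1#
      ; isCommutativeRing = record
        { isRing = record
          { +-isAbelianGroup = record
            { isGroup = record
              { isMonoid = record
                { isSemigroup = record
                  { isMagma = record
                    { isEquivalence = record
                      { refl = reflexive-mod refl ; sym = sym-mod ; trans = trans-mod }
                    ; ∙-cong = +-cong-mod
                    }
                  ; assoc = λ x y z → reflexive-mod (+-assoc x y z)
                  }
                ; identity = (λ x → reflexive-mod (+-identityˡ x))
                           , (λ x → reflexive-mod (+-identityʳ x))
                }
              ; inverse = (λ x → reflexive-mod (-‿inverseˡ x))
                        , (λ x → reflexive-mod (-‿inverseʳ x))
              ; ⁻¹-cong = -‿cong-mod
              }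
            ; comm = λ x y → reflexive-mod (+-comm x y)
            }
          ; *-cong = *-cong-mod
          ; *-assoc = λ x y z → reflexive-mod (*-assoc x y z)
          ; *-identity = (λ x → reflexive-mod (*-identityˡ x))
                       , (λ x → reflexive-mod (*-identityʳ x))
          ; distrib = (λ x y z → reflexive-mod (distribˡ x y z))
                    , (λ x y z → reflexive-mod (distribʳ x y z))
          }
        ; *-comm = λ x y → reflexive-mod (*-comm x y)
        }
      }

    quotientModule : Module R c (c ⊔ ℓ ⊔ s)
    quotientModule = record
      { Carrierᴹ = Carrier
      ; isModule = IsModuleFromLeft.isModule {commutativeRing = R} (record
        { isLeftModule = record
          { isLeftSemimodule = record
            { +ᴹ-isCommutativeMonoid = Q.+-isCommutativeMonoid
            ; isPreleftSemimodule = record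
              { *ₗ-cong = λ x≈y u≈v → Q.*-cong (reflexive-mod x≈y) u≈v
              ; *ₗ-zeroˡ = Q.zeroˡ
              ; *ₗ-distribʳ = λ x y z → Q.distribʳ x y z
              ; *ₗ-identityˡ = Q.*-identityˡ
              ; *ₗ-assoc = Q.*-assoc
              ; *ₗ-zeroʳ = Q.zeroʳ
              ; *ₗ-distribˡ = Q.distribˡ
              }
            }
          ; -ᴹ‿cong = Q.-‿cong
          ; -ᴹ‿inverse = Q.-‿inverse
          }
        })
      }
      where module Q = CommutativeRing quotientRing

module _ {c ℓ} (R : CommutativeRing c ℓ) where
  open CommutativeRing R

  freeModule : ℕ → Module R c ℓ
  freeModule n = record
    { Carrierᴹ = Fin n → Carrier
    ; _*ₗ_ = λ r x j → r * x j
    ; isModule = IsModuleFromLeft.isModule {commutativeRing = R} (record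
      { isLeftModule = record
        { isLeftSemimodule = record
          { +ᴹ-isCommutativeMonoid =
              Pointwise.isCommutativeMonoid (Fin n) +-isCommutativeMonoid
          ; isPreleftSemimodule = record
            { *ₗ-cong = λ r≈s x≈y j → *-cong r≈s (x≈y j)
            ; *ₗ-zeroˡ = λ x j → zeroˡ (x j)
            ; *ₗ-distribʳ = λ x r s j → distribʳ (x j) r s
            ; *ₗ-identityˡ = λ x j → *-identityˡ (x j)
            ; *ₗ-assoc = λ r s x j → *-assoc r s (x j)
            ; *ₗ-zeroʳ = λ r j → zeroʳ r
            ; *ₗ-distribˡ = λ r x y j → distribˡ r (x j) (y j)
            }
          }
        ; -ᴹ‿cong = λ x≈y j → -‿cong (x≈y j)
        ; -ᴹ‿inverse = (λ x j → -‿inverseˡ (x j)) , (λ x j → -‿inverseʳ (x j))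
        }
      })
    }

Exponent : ℕ → Set
Exponent = Vec ℕ

infixl 6 _+ᵉ_
_+ᵉ_ : ∀ {m} → Exponent m → Exponent m → Exponent m
_+ᵉ_ = zipWith ℕ._+_

0ᵉ : ∀ {m} → Exponent m
0ᵉ = replicate _ 0

infix 4 _≟ᵉ_
_≟ᵉ_ : ∀ {m} (a b : Exponent m) → Dec (a ≡ b)
_≟ᵉ_ = Vec.≡-dec ℕ._≟_

indicator : ∀ {m} → Subset m → Exponent m
indicator = Vec.map (if_then 1 else 0)

module Polynomials {c ℓ} (k : CommutativeRing c ℓ) (m : ℕ) where
  open CommutativeRing k

  -- A list of terms (s , b) stands for the finite sum of the s·v^b;
  -- exponents may repeat, and two lists are identified when all
  -- coefficients agree.
  Polynomial : Set c
  Polynomial = List (Carrier × Exponent m)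

  -- The k-linear functional on k[v] with v^b ↦ φ b.
  linear : (Exponent m → Carrier) → Polynomial → Carrier
  linear φ []            = 0#
  linear φ ((s , b) ∷ p) = s * φ b + linear φ p

  δ : Exponent m → Exponent m → Carrier
  δ a b = if does (a ≟ᵉ b) then 1# else 0#

  coeff : Polynomial → Exponent m → Carrier
  coeff p a = linear (δ a) p

  infix 4 _≈ᵖ_
  record _≈ᵖ_ (p q : Polynomial) : Set ℓ where
    constructor coefficientwise
    field at : ∀ a → coeff p a ≈ coeff q a

  open _≈ᵖ_ public

  _·ᵗ_ : Carrier × Exponent m → Carrier × Exponent m → Carrier × Exponent m
  (s , b) ·ᵗ (t , c) = s * t , b +ᵉ c

  infixl 6 _+ᵖ_
  infixl 7 _*ᵖ_
  infix  8 -ᵖ_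

  _+ᵖ_ _*ᵖ_ : Polynomial → Polynomial → Polynomial
  _+ᵖ_ = _++_
  _*ᵖ_ = cartesianProductWith _·ᵗ_

  -ᵖ_ : Polynomial → Polynomial
  -ᵖ_ = List.map (map₁ (-_))

  monomial : Exponent m → Polynomial
  monomial a = [ 1# , a ]

  open RingProperties ring using (-‿distribˡ-*; -0#≈0#; -‿+-comm)
  open CommutativeSemigroupProperties +-commutativeSemigroup using (interchange)
  open CommutativeSemigroupProperties *-commutativeSemigroup using (x∙yz≈y∙xz)

  linear-cong : ∀ {φ ψ} p → (∀ b → φ b ≈ ψ b) → linear φ p ≈ linear ψ p
  linear-cong []            eq = refl
  linear-cong ((s , b) ∷ p) eq = +-cong (*-congˡ (eq b)) (linear-cong p eq)

  linear-++ : ∀ φ p q → linear φ (p ++ q) ≈ linear φ p + linear φ q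
  linear-++ φ []            q = sym (+-identityˡ _)
  linear-++ φ ((s , b) ∷ p) q =
    trans (+-congˡ (linear-++ φ p q)) (sym (+-assoc _ _ _))

  linear-neg : ∀ φ p → linear φ (-ᵖ p) ≈ - linear φ p
  linear-neg φ []            = sym -0#≈0#
  linear-neg φ ((s , b) ∷ p) =
    trans (+-cong (sym (-‿distribˡ-* s (φ b))) (linear-neg φ p)) (-‿+-comm _ _)

  linear-zero : ∀ p → linear (λ _ → 0#) p ≈ 0#
  linear-zero []            = refl
  linear-zero ((s , b) ∷ p) = trans (+-cong (zeroʳ s) (linear-zero p)) (+-identityˡ 0#)

  linear-+ : ∀ φ ψ p → linear (λ b → φ b + ψ b) p ≈ linear φ p + linear ψ p
  linear-+ φ ψ []            = sym (+-identityˡ 0#)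
  linear-+ φ ψ ((s , b) ∷ p) =
    trans (+-cong (distribˡ s (φ b) (ψ b)) (linear-+ φ ψ p)) (interchange _ _ _ _)

  linear-* : ∀ t φ p → linear (λ b → t * φ b) p ≈ t * linear φ p
  linear-* t φ []            = sym (zeroʳ t)
  linear-* t φ ((s , b) ∷ p) =
    trans (+-cong (x∙yz≈y∙xz s t (φ b)) (linear-* t φ p)) (sym (distribˡ t _ _))

  linear-swap : ∀ (φ : Exponent m → Exponent m → Carrier) p q →
    linear (λ b → linear (φ b) q) p ≈ linear (λ c → linear (λ b → φ b c) p) q
  linear-swap φ []            q = sym (linear-zero q)
  linear-swap φ ((s , b) ∷ p) q = trans
    (+-cong (sym (linear-* s (φ b) q)) (linear-swap φ p q))
    (sym (linear-+ (λ c → s * φ b c) (λ c → linear (λ b → φ b c) p) q))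

  linear-term : ∀ φ s b q →
    linear φ (List.map ((s , b) ·ᵗ_) q) ≈ s * linear (λ c → φ (b +ᵉ c)) q
  linear-term φ s b []            = sym (zeroʳ s)
  linear-term φ s b ((t , c) ∷ q) =
    trans (+-cong (*-assoc s t _) (linear-term φ s b q)) (sym (distribˡ s _ _))

  linear-product : ∀ φ p q →
    linear φ (p *ᵖ q) ≈ linear (λ b → linear (λ c → φ (b +ᵉ c)) q) p
  linear-product φ []            q = refl
  linear-product φ ((s , b) ∷ p) q = trans
    (linear-++ φ (List.map ((s , b) ·ᵗ_) q) (p *ᵖ q))
    (+-cong (linear-term φ s b q) (linear-product φ p q))

  +ᵉ-assoc : ∀ a b c → (a +ᵉ b) +ᵉ c ≡ a +ᵉ (b +ᵉ c)
  +ᵉ-assoc = Vec.zipWith-assoc {n = m} ℕ.+-assoc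

  +ᵉ-comm : ∀ a b → a +ᵉ b ≡ b +ᵉ a
  +ᵉ-comm = Vec.zipWith-comm {n = m} ℕ.+-comm

  +ᵉ-identityˡ : ∀ a → 0ᵉ +ᵉ a ≡ a
  +ᵉ-identityˡ = Vec.zipWith-identityˡ {n = m} ℕ.+-identityˡ

  infixl 6 _∸ᵉ_
  _∸ᵉ_ : ∀ {n} → Exponent n → Exponent n → Exponent n
  _∸ᵉ_ = zipWith ℕ._∸_

  +ᵉ-∸ᵉ : ∀ {n} (b c : Exponent n) → (b +ᵉ c) ∸ᵉ b ≡ c
  +ᵉ-∸ᵉ []      []      = ≡.refl
  +ᵉ-∸ᵉ (x ∷ b) (y ∷ c) = ≡.cong₂ _∷_ (ℕ.m+n∸m≡n x y) (+ᵉ-∸ᵉ b c)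

  -- c ↦ δ a (b + c) is either δ (a ∸ b) or zero.
  δ-shift-≡ : ∀ a b c → b +ᵉ (a ∸ᵉ b) ≡ a → δ a (b +ᵉ c) ≈ δ (a ∸ᵉ b) c
  δ-shift-≡ a b c eq with a ≟ᵉ b +ᵉ c | (a ∸ᵉ b) ≟ᵉ c
  ... | yes _      | yes _ = refl
  ... | no  _      | no  _ = refl
  ... | yes ≡.refl | no ¬p = contradiction (+ᵉ-∸ᵉ b c) ¬p
  ... | no ¬p | yes ≡.refl = contradiction (≡.sym eq) ¬p

  δ-shift-≢ : ∀ a b c → b +ᵉ (a ∸ᵉ b) ≢ a → δ a (b +ᵉ c) ≈ 0#
  δ-shift-≢ a b c neq with a ≟ᵉ b +ᵉ c
  ... | yes ≡.refl = contradiction (≡.cong (b +ᵉ_) (+ᵉ-∸ᵉ b c)) neq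
  ... | no  _      = refl

  linear-δ-cong : ∀ a b {p q} → p ≈ᵖ q →
    linear (λ c → δ a (b +ᵉ c)) p ≈ linear (λ c → δ a (b +ᵉ c)) q
  linear-δ-cong a b {p} {q} p≈q with b +ᵉ (a ∸ᵉ b) ≟ᵉ a
  ... | yes eq = trans (linear-cong p (λ c → δ-shift-≡ a b c eq))
                   (trans (at p≈q (a ∸ᵉ b)) (sym (linear-cong q (λ c → δ-shift-≡ a b c eq))))
  ... | no neq = trans (trans (linear-cong p (λ c → δ-shift-≢ a b c neq)) (linear-zero p))
                   (sym (trans (linear-cong q (λ c → δ-shift-≢ a b c neq)) (linear-zero q)))

  *ᵖ-comm : ∀ p q → p *ᵖ q ≈ᵖ q *ᵖ p
  *ᵖ-comm p q .at a = trans (linear-product (δ a) p q)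
    (trans (linear-swap (λ b c → δ a (b +ᵉ c)) p q)
    (trans (linear-cong q (λ c → linear-cong p (λ b →
             reflexive (≡.cong (δ a) (+ᵉ-comm b c)))))
           (sym (linear-product (δ a) q p))))

  *ᵖ-congˡ : ∀ p {q r} → q ≈ᵖ r → p *ᵖ q ≈ᵖ p *ᵖ r
  *ᵖ-congˡ p {q} {r} q≈r .at a = trans (linear-product (δ a) p q)
    (trans (linear-cong p (λ b → linear-δ-cong a b q≈r))
           (sym (linear-product (δ a) p r)))

  *ᵖ-cong : ∀ {p q r s} → p ≈ᵖ q → r ≈ᵖ s → p *ᵖ r ≈ᵖ q *ᵖ s
  *ᵖ-cong {p} {q} {r} {s} p≈q r≈s .at a =
    trans (at (*ᵖ-congˡ p r≈s) a)
    (trans (at (*ᵖ-comm p s) a) (trans (at (*ᵖ-congˡ s p≈q) a) (at (*ᵖ-comm s q) a)))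

  *ᵖ-assoc : ∀ p q r → (p *ᵖ q) *ᵖ r ≈ᵖ p *ᵖ (q *ᵖ r)
  *ᵖ-assoc p q r .at a = trans (linear-product (δ a) (p *ᵖ q) r)
    (trans (linear-product (λ d → linear (λ e → δ a (d +ᵉ e)) r) p q)
    (trans (linear-cong p (λ b → trans
             (linear-cong q (λ c → linear-cong r (λ e →
               reflexive (≡.cong (δ a) (+ᵉ-assoc b c e)))))
             (sym (linear-product (λ d → δ a (b +ᵉ d)) q r))))
           (sym (linear-product (δ a) p (q *ᵖ r)))))

  *ᵖ-identityˡ : ∀ p → monomial 0ᵉ *ᵖ p ≈ᵖ p
  *ᵖ-identityˡ p .at a = trans (linear-product (δ a) (monomial 0ᵉ) p)
    (trans (+-identityʳ _) (trans (*-identityˡ _)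
      (linear-cong p (λ c → reflexive (≡.cong (δ a) (+ᵉ-identityˡ c))))))

  *ᵖ-distribʳ : ∀ r p q → (p +ᵖ q) *ᵖ r ≈ᵖ (p *ᵖ r) +ᵖ (q *ᵖ r)
  *ᵖ-distribʳ r p q .at a = trans (linear-product (δ a) (p +ᵖ q) r)
    (trans (linear-++ _ p q)
    (trans (+-cong (sym (linear-product (δ a) p r)) (sym (linear-product (δ a) q r)))
           (sym (linear-++ (δ a) (p *ᵖ r) (q *ᵖ r)))))

  +ᵖ-cong : ∀ {p q r s} → p ≈ᵖ q → r ≈ᵖ s → p +ᵖ r ≈ᵖ q +ᵖ s
  +ᵖ-cong {p} {q} {r} {s} p≈q r≈s .at a = trans (linear-++ (δ a) p r)
    (trans (+-cong (at p≈q a) (at r≈s a)) (sym (linear-++ (δ a) q s)))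

  +ᵖ-comm : ∀ p q → p +ᵖ q ≈ᵖ q +ᵖ p
  +ᵖ-comm p q .at a = trans (linear-++ (δ a) p q)
    (trans (+-comm _ _) (sym (linear-++ (δ a) q p)))

  *ᵖ-distribˡ : ∀ r p q → r *ᵖ (p +ᵖ q) ≈ᵖ (r *ᵖ p) +ᵖ (r *ᵖ q)
  *ᵖ-distribˡ r p q .at a = trans (at (*ᵖ-comm r (p +ᵖ q)) a)
    (trans (at (*ᵖ-distribʳ r p q) a)
           (at (+ᵖ-cong (*ᵖ-comm p r) (*ᵖ-comm q r)) a))

  -ᵖ-cong : ∀ {p q} → p ≈ᵖ q → -ᵖ p ≈ᵖ -ᵖ q
  -ᵖ-cong {p} {q} p≈q .at a = trans (linear-neg (δ a) p)
    (trans (-‿cong (at p≈q a)) (sym (linear-neg (δ a) q)))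

  -ᵖ-inverseʳ : ∀ p → p +ᵖ -ᵖ p ≈ᵖ []
  -ᵖ-inverseʳ p .at a = trans (linear-++ (δ a) p (-ᵖ p))
    (trans (+-congˡ (linear-neg (δ a) p)) (-‿inverseʳ _))

  +ᵖ-assoc : ∀ p q r → (p +ᵖ q) +ᵖ r ≈ᵖ p +ᵖ (q +ᵖ r)
  +ᵖ-assoc p q r .at a = reflexive (≡.cong (linear (δ a)) (List.++-assoc p q r))

  polynomialRing : CommutativeRing c ℓ
  polynomialRing = record
    { Carrier = Polynomial
    ; _≈_ = _≈ᵖ_
    ; _+_ = _+ᵖ_
    ; _*_ = _*ᵖ_
    ; -_  = -ᵖ_
    ; 0#  = []
    ; 1#  = monomial 0ᵉ
    ; isCommutativeRing = record
      { isRing = record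
        { +-isAbelianGroup = record
          { isGroup = record
            { isMonoid = record
              { isSemigroup = record
                { isMagma = record
                  { isEquivalence = record
                    { refl  = λ where .at a → refl
                    ; sym   = λ where p≈q .at a → sym (at p≈q a)
                    ; trans = λ where p≈q q≈r .at a → trans (at p≈q a) (at q≈r a)
                    }
                  ; ∙-cong = +ᵖ-cong
                  }
                ; assoc = +ᵖ-assoc
                }
              ; identity = (λ where p .at a → refl)
                         , (λ p → +ᵖ-comm p [])
              }
            ; inverse = (λ where p .at a → trans (at (+ᵖ-comm (-ᵖ p) p) a) (at (-ᵖ-inverseʳ p) a))
                      , -ᵖ-inverseʳ
            ; ⁻¹-cong = -ᵖ-cong
            }
          ; comm = +ᵖ-comm
          }
        ; *-cong = *ᵖ-cong
        ; *-assoc = *ᵖ-assoc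
        ; *-identity = *ᵖ-identityˡ
                     , (λ where p .at a → trans (at (*ᵖ-comm p (monomial 0ᵉ)) a) (at (*ᵖ-identityˡ p) a))
        ; distrib = *ᵖ-distribˡ , *ᵖ-distribʳ
        }
      ; *-comm = *ᵖ-comm
      }
    }

-- Constructively a field comes with an apartness relation; for a discrete
-- field it is the negation of equality.
module FaceRings {c ℓ₁ ℓ₂} (k : HeytingField c ℓ₁ ℓ₂) (m : ℕ) where

  private
    kᴿ : CommutativeRing c ℓ₁
    kᴿ = HeytingCommutativeRing.commutativeRing (HeytingField.heytingCommutativeRing k)

  open HeytingField k using (_≈_; 0#)
  open Polynomials kᴿ m
  open Ideals polynomialRing

  v^_ : Subset m → Polynomial
  v^ a = monomial (indicator a)

  NonFaceMonomial : Pred (Subset m) 0ℓ → Pred Polynomial ℓ₁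
  NonFaceMonomial K p = ∃[ τ ] ¬ K τ × p ≈ᵖ v^ τ

  faceRing : Pred (Subset m) 0ℓ → CommutativeRing c (c ⊔ ℓ₁)
  faceRing K = quotientRing (NonFaceMonomial K)

  faceRingᴹ : Pred (Subset m) 0ℓ → Module polynomialRing c (c ⊔ ℓ₁)
  faceRingᴹ K = quotientModule (NonFaceMonomial K)

  𝔪 : Pred Polynomial (c ⊔ ℓ₁)
  𝔪 = ⟨ (λ p → ∃[ i ] p ≈ᵖ v^ ⁅ i ⁆) ⟩

  -- Homogeneity of degree a in the free module ⨁ⱼ k[v](-sⱼ): the j-th
  -- coordinate is a multiple of v^(a - sⱼ), and is zero if sⱼ ≰ a.
  Homogeneous-⨁ : ∀ {n} → (Fin n → Exponent m) → Exponent m →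
                  Pred (Fin n → Polynomial) ℓ₁
  Homogeneous-⨁ s a x = ∀ j b → s j +ᵉ b ≢ a → coeff (x j) b ≈ 0#

  Homogeneous : Exponent m → Pred Polynomial ℓ₁
  Homogeneous a p = ∀ b → b ≢ a → coeff p b ≈ 0#

  Homogeneous-faceRing : (K : Pred (Subset m) 0ℓ) → Exponent m → Pred Polynomial (c ⊔ ℓ₁)
  Homogeneous-faceRing K a p =
    ∃[ q ] Homogeneous a q × CommutativeRing._≈_ (faceRing K) p q

  record MinimalFreeResolution (K : Pred (Subset m) 0ℓ) : Set (c ⊔ ℓ₁) where
    field
      h     : ℕ
      rank  : ℕ → ℕ
      shift : ∀ i → Fin (rank i) → Exponent m

      rank-h   : rank h ≢ 0
      rank->h  : ∀ {i} → h ℕ.< i → rank i ≡ 0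

    -- F i = ⨁ⱼ k[v](-shift i j)
    F : ℕ → Module polynomialRing c ℓ₁
    F i = freeModule polynomialRing (rank i)

    module F i = Module (F i)
    module k[K] = Module (faceRingᴹ K)

    field
      ε            : F.Carrierᴹ 0 → k[K].Carrierᴹ
      ε-hom        : ModuleMorphisms.IsModuleHomomorphism
                       (F.rawModule 0) k[K].rawModule ε
      ε-graded     : ∀ {a x} → Homogeneous-⨁ (shift 0) a x → Homogeneous-faceRing K a (ε x)
      ε-surjective : Surjective (F._≈ᴹ_ 0) k[K]._≈ᴹ_ ε

      d            : ∀ i → F.Carrierᴹ (suc i) → F.Carrierᴹ i
      d-hom        : ∀ i → ModuleMorphisms.IsModuleHomomorphism
                       (F.rawModule (suc i)) (F.rawModule i) (d i)
      d-graded     : ∀ i {a x} → Homogeneous-⨁ (shift (suc i)) a x →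
                     Homogeneous-⨁ (shift i) a (d i x)

      exact-0      : ∀ x → ε x k[K].≈ᴹ k[K].0ᴹ ⇔ (∃[ y ] F._≈ᴹ_ 0 (d 0 y) x)
      exact-suc    : ∀ i x → F._≈ᴹ_ i (d i x) (F.0ᴹ i) ⇔
                     (∃[ y ] F._≈ᴹ_ (suc i) (d (suc i) y) x)

      -- d (F (suc i)) ⊆ 𝔪 (F i), the right-hand side being 𝔪ⁿ for F i = k[v]ⁿ.
      minimal      : ∀ i x j → 𝔪 (d i x j)

    -- The exponent of k[v](-a) in F i.
    β : ℕ → Exponent m → ℕ
    β i a = length (filter (λ j → shift i j ≟ᵉ a) (allFin (rank i)))

    β[_,_] : ℕ → Subset m → ℕ
    β[ i , a ] = β i (indicator a)

open FaceRings public using (MinimalFreeResolution; module MinimalFreeResolution)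

{-# OPTIONS --safe #-}
-- Fix a ⊆ [m].  The degree-a strand of the resolution is an exact sequence of
-- finite-dimensional vector spaces whose i-th term has dimension
-- #{ j | v^(shift i j) divides v^a }, resolving the degree-a part of k(K), which has dimension
-- f a.  Hence modulo 2 the dimensions add up to f a.  On squarefree degrees the dimension is
-- ∑_{b ⊆ a} β[ i , b ], so f is the Möbius transform of b ↦ ∑ᵢ β[ i , b ] mod 2.  Since the
-- transform is an involution, Möbius f is that parity function, and an odd number is at least 1.
--
-- The field need not be discrete, so ranks exist only up to double negation; this suffices
-- because parities have decidable equality.
module Submission where

open import Defs
open import Level using (Level; _⊔_; 0ℓ)
open import Algebra.Apartness.Bundles using (HeytingField; HeytingCommutativeRing)
open import Algebra.Bundles using (CommutativeMonoid; CommutativeRing; Ring)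
open import Algebra.Module.Bundles using (LeftModule; Module)
open import Algebra.Module.Morphism.Structures using (module LeftModuleMorphisms; module ModuleMorphisms)
import Algebra.Properties.AbelianGroup as AbelianGroupProperties
import Algebra.Properties.CommutativeSemigroup as CommutativeSemigroupProperties
import Algebra.Properties.Ring as RingProperties
open import Data.Bool.Base using (true; false; if_then_else_)
open import Data.Fin.Base using (Fin; zero; suc)
open import Data.Fin.Subset as Subset using (Subset; inside; outside)
open import Data.Fin.Subset.Properties using (_⊆?_)
open import Data.List.Base as List
  using (List; []; _∷_; _++_; map; filter; foldr; length; sum; upTo; allFin; tabulate)
import Data.List.Properties as List
open import Data.Nat.Base as ℕ using (ℕ; zero; suc; NonZero; _≤_; z≤n; s≤s; parity)
open import Data.Nat.ListAction.Properties using (sum-++)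
import Data.Nat.Properties as ℕ
open import Data.Parity.Base using (Parity; 0ℙ; 1ℙ; _⁻¹) renaming (_+_ to _+ℙ_)
import Data.Parity.Properties as Parity
open import Data.Parity.Properties using (suc-homo-⁻¹; ⁻¹-involutive; +-homo-+)
open import Data.Product.Base using (_×_; _,_; ∃-syntax; proj₁; proj₂)
open import Data.Sum.Base using (_⊎_; inj₁; inj₂)
open import Data.Vec.Base as Vec using (Vec; []; _∷_; here; there)
import Data.Vec.Properties as Vec
open import Function.Base using (_∘_; id)
open import Function.Bundles using (Equivalence)
open import Relation.Binary.PropositionalEquality as ≡ using (_≡_; _≢_; _≗_)
import Relation.Binary.Reasoning.Setoid as SetoidReasoning
open import Relation.Nullary using (Dec; does; yes; no; ¬_; contradiction)
open import Relation.Nullary.Decidable using (¬¬-excluded-middle; decidable-stable)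
open import Relation.Nullary.Negation using (¬¬-map; DoubleNegation)
open import Relation.Unary using (Pred; _≐_; _⊆_; Decidable)

-- Exactness is a statement about the whole modules, and a preimage that it yields need not be
-- homogeneous. To pass to a strand, elements are projected onto one multidegree, and a graded map
-- is shown to commute with this projection by checking it on homogeneous elements and their sums.
-- For `k(K)` the coefficient of v^a takes the place of the projection: when `a` is a face, no
-- nonface monomial divides v^a, so this coefficient vanishes on the defining ideal, is well defined
-- on classes, and detects that v^a is nonzero. Working modulo 2 removes the alternating signs of
-- the Euler characteristic, so the plain sum of the dimensions can be compared with `f a`. Bases of
-- kernels and images exist only classically, but two dimensions of the same space are outright
-- equal, since equality of natural numbers is decidable.

-- The Möbius transform modulo 2.

module MöbiusTransform where
  open ≡ using (refl; sym; trans; cong; cong₂; module ≡-Reasoning)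
  open CommutativeSemigroupProperties Parity.+-commutativeSemigroup using (interchange)

  ∑ : List Parity → Parity
  ∑ = foldr _+ℙ_ 0ℙ

  ∑-++ : ∀ xs ys → ∑ (xs ++ ys) ≡ ∑ xs +ℙ ∑ ys
  ∑-++ []       ys = refl
  ∑-++ (x ∷ xs) ys = trans (cong (x +ℙ_) (∑-++ xs ys)) (sym (Parity.+-assoc x (∑ xs) (∑ ys)))

  private variable
    m : ℕ

  -- The list is a parameter because induction on the ground set splits `subsets (suc m)` into two
  -- mapped copies of `subsets m`.
  Σ⊆ : PowerFunction m → Subset m → List (Subset m) → Parity
  Σ⊆ f a xs = ∑ (map f (filter (_⊆? a) xs))

  Σ⊆-++ : ∀ f (a : Subset m) xs ys → Σ⊆ f a (xs ++ ys) ≡ Σ⊆ f a xs +ℙ Σ⊆ f a ys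
  Σ⊆-++ f a xs ys = trans
    (cong ∑ (trans (cong (map f) (List.filter-++ (_⊆? a) xs ys))
                   (List.map-++ f (filter (_⊆? a) xs) (filter (_⊆? a) ys))))
    (∑-++ (map f (filter (_⊆? a) xs)) _)

  Σ⊆-outside : ∀ (f : PowerFunction (suc m)) y a xs →
    Σ⊆ f (y ∷ a) (map (outside ∷_) xs) ≡ Σ⊆ (f ∘ (outside ∷_)) a xs
  Σ⊆-outside f y a []       = refl
  Σ⊆-outside f y a (x ∷ xs) with does (x ⊆? a)
  ... | true  = cong (f (outside ∷ x) +ℙ_) (Σ⊆-outside f y a xs)
  ... | false = Σ⊆-outside f y a xs

  Σ⊆-inside-inside : ∀ (f : PowerFunction (suc m)) a xs →
    Σ⊆ f (inside ∷ a) (map (inside ∷_) xs) ≡ Σ⊆ (f ∘ (inside ∷_)) a xs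
  Σ⊆-inside-inside f a []       = refl
  Σ⊆-inside-inside f a (x ∷ xs) with does (x ⊆? a)
  ... | true  = cong (f (inside ∷ x) +ℙ_) (Σ⊆-inside-inside f a xs)
  ... | false = Σ⊆-inside-inside f a xs

  Σ⊆-inside-outside : ∀ (f : PowerFunction (suc m)) a xs →
    Σ⊆ f (outside ∷ a) (map (inside ∷_) xs) ≡ 0ℙ
  Σ⊆-inside-outside f a []       = refl
  Σ⊆-inside-outside f a (x ∷ xs) = Σ⊆-inside-outside f a xs

  Möbius-outside : ∀ (f : PowerFunction (suc m)) a →
    Möbius f (outside ∷ a) ≡ Möbius (f ∘ (outside ∷_)) a
  Möbius-outside {m} f a = trans
    (Σ⊆-++ f (outside ∷ a) (map (outside ∷_) (subsets m)) (map (inside ∷_) (subsets m)))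
    (trans (cong₂ _+ℙ_ (Σ⊆-outside f outside a (subsets m)) (Σ⊆-inside-outside f a (subsets m)))
           (Parity.+-identityʳ _))

  Möbius-inside : ∀ (f : PowerFunction (suc m)) a →
    Möbius f (inside ∷ a) ≡ Möbius (f ∘ (outside ∷_)) a +ℙ Möbius (f ∘ (inside ∷_)) a
  Möbius-inside {m} f a = trans
    (Σ⊆-++ f (inside ∷ a) (map (outside ∷_) (subsets m)) (map (inside ∷_) (subsets m)))
    (cong₂ _+ℙ_ (Σ⊆-outside f inside a (subsets m)) (Σ⊆-inside-inside f a (subsets m)))

  Möbius-cong : ∀ {f g : PowerFunction m} → f ≗ g → Möbius f ≗ Möbius g
  Möbius-cong f≗g a = cong ∑ (List.map-cong f≗g (filter (_⊆? a) (subsets _)))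

  Möbius-+ : ∀ (f g : PowerFunction m) a → Möbius (λ b → f b +ℙ g b) a ≡ Möbius f a +ℙ Möbius g a
  Möbius-+ f g a = go (filter (_⊆? a) (subsets _))
    where
    go : ∀ xs → ∑ (map (λ b → f b +ℙ g b) xs) ≡ ∑ (map f xs) +ℙ ∑ (map g xs)
    go []       = refl
    go (x ∷ xs) = trans (cong (f x +ℙ g x +ℙ_) (go xs))
      (interchange (f x) (g x) (∑ (map f xs)) (∑ (map g xs)))

  Möbius-0 : ∀ (a : Subset m) → Möbius (λ _ → 0ℙ) a ≡ 0ℙ
  Möbius-0 a = go (filter (_⊆? a) (subsets _))
    where
    go : ∀ (xs : List (Subset _)) → ∑ (map (λ _ → 0ℙ) xs) ≡ 0ℙ
    go []       = refl
    go (x ∷ xs) = go xs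

  -- In terms of the two halves of `f`, the transform M sends (fₒ, fᵢ) to (M fₒ, M fₒ + M fᵢ).
  -- Applied twice, it produces the term in fₒ twice in the second half, and this cancels in
  -- characteristic 2.
  Möbius-involutive : ∀ (f : PowerFunction m) → Möbius (Möbius f) ≗ f
  Möbius-involutive f [] = trans (Parity.+-identityʳ _) (Parity.+-identityʳ _)
  Möbius-involutive f (outside ∷ a) = begin
    Möbius (Möbius f) (outside ∷ a)           ≡⟨ Möbius-outside (Möbius f) a ⟩
    Möbius (Möbius f ∘ (outside ∷_)) a        ≡⟨ Möbius-cong (Möbius-outside f) a ⟩
    Möbius (Möbius (f ∘ (outside ∷_))) a      ≡⟨ Möbius-involutive (f ∘ (outside ∷_)) a ⟩
    f (outside ∷ a)                           ∎
    where open ≡-Reasoning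
  Möbius-involutive f (inside ∷ a) = begin
    Möbius (Möbius f) (inside ∷ a)
      ≡⟨ Möbius-inside (Möbius f) a ⟩
    Möbius (Möbius f ∘ (outside ∷_)) a +ℙ Möbius (Möbius f ∘ (inside ∷_)) a
      ≡⟨ cong₂ _+ℙ_ (Möbius-cong (Möbius-outside f) a)
                   (trans (Möbius-cong (Möbius-inside f) a) (Möbius-+ (Möbius fₒ) (Möbius fᵢ) a)) ⟩
    Möbius (Möbius fₒ) a +ℙ (Möbius (Möbius fₒ) a +ℙ Möbius (Möbius fᵢ) a)
      ≡⟨ Parity.+-assoc (Möbius (Möbius fₒ) a) _ _ ⟨
    (Möbius (Möbius fₒ) a +ℙ Möbius (Möbius fₒ) a) +ℙ Möbius (Möbius fᵢ) a
      ≡⟨ cong (_+ℙ Möbius (Möbius fᵢ) a) (Parity.p+p≡0ℙ (Möbius (Möbius fₒ) a)) ⟩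
    Möbius (Möbius fᵢ) a
      ≡⟨ Möbius-involutive fᵢ a ⟩
    f (inside ∷ a) ∎
    where
    open ≡-Reasoning
    fₒ fᵢ : PowerFunction _
    fₒ = f ∘ (outside ∷_)
    fᵢ = f ∘ (inside ∷_)

  -- Divisibility of monomials and the transform of degree counts.

  infix 4 _∣ᵉ_ _∣ᵉ?_

  -- v^s divides v^e; as ∸ truncates, s + (e ∸ s) differs from e as soon as s ≰ e.
  _∣ᵉ_ : Exponent m → Exponent m → Set
  s ∣ᵉ e = s +ᵉ Vec.zipWith ℕ._∸_ e s ≡ e

  _∣ᵉ?_ : ∀ (s e : Exponent m) → Dec (s ∣ᵉ e)
  s ∣ᵉ? e = s +ᵉ Vec.zipWith ℕ._∸_ e s ≟ᵉ e

  𝟙[_] : ∀ {P : Set} → Dec P → Parity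
  𝟙[ P? ] = if does P? then 1ℙ else 0ℙ

  𝟙-cong : ∀ {P Q : Set} (P? : Dec P) (Q? : Dec Q) → (P → Q) → (Q → P) → 𝟙[ P? ] ≡ 𝟙[ Q? ]
  𝟙-cong (yes p) (yes q) _ _ = refl
  𝟙-cong (yes p) (no ¬q) f _ = contradiction (f p) ¬q
  𝟙-cong (no ¬p) (yes q) _ g = contradiction (g q) ¬p
  𝟙-cong (no ¬p) (no ¬q) _ _ = refl

  𝟙-no : ∀ {P : Set} (P? : Dec P) → ¬ P → 𝟙[ P? ] ≡ 0ℙ
  𝟙-no (yes p) ¬p = contradiction p ¬p
  𝟙-no (no  _) _  = refl

  Möbius-∅ : ∀ {P : Subset m → Set} (P? : ∀ b → Dec (P b)) → (∀ b → ¬ P b) → ∀ a →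
    Möbius (λ b → 𝟙[ P? b ]) a ≡ 0ℙ
  Möbius-∅ P? ¬P a = trans (Möbius-cong (λ b → 𝟙-no (P? b) (¬P b)) a) (Möbius-0 a)

  -- The divisors of a squarefree monomial are the monomials of the subsets. Hence both sides vanish
  -- when `s` has an entry above 1, and `s` may be any exponent.
  Möbius-δ : ∀ (s : Exponent m) a →
    Möbius (λ b → 𝟙[ s ≟ᵉ indicator b ]) a ≡ 𝟙[ s ∣ᵉ? indicator a ]

  -- The pairs (0, 0), (0, 1) and (1, 1) of heads `x` and `y` share this argument: the head has
  -- already matched, so both sides reduce to the tails.
  Möbius-δ-∷ : ∀ x (s : Exponent m) y a (∷∣? : Dec (x ∷ s ∣ᵉ y ∷ indicator a)) →
    (s ∣ᵉ indicator a → x ∷ s ∣ᵉ y ∷ indicator a) →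
    Möbius (λ b → 𝟙[ x ∷ s ≟ᵉ x ∷ indicator b ]) a ≡ 𝟙[ ∷∣? ]
  Möbius-δ-∷ x s y a ∷∣? ∣⇒∷∣ = trans
    (Möbius-cong (λ b → 𝟙-cong (x ∷ s ≟ᵉ x ∷ indicator b) (s ≟ᵉ indicator b)
      Vec.∷-injectiveʳ (cong (x ∷_))) a)
    (trans (Möbius-δ s a) (𝟙-cong (s ∣ᵉ? indicator a) ∷∣? ∣⇒∷∣ Vec.∷-injectiveʳ))

  Möbius-δ []      []            = refl
  Möbius-δ (x ∷ s) (outside ∷ a) = trans (Möbius-outside (λ b → 𝟙[ x ∷ s ≟ᵉ indicator b ]) a) (go x)
    where
    go : ∀ x → Möbius (λ b → 𝟙[ x ∷ s ≟ᵉ 0 ∷ indicator b ]) a ≡ 𝟙[ x ∷ s ∣ᵉ? 0 ∷ indicator a ]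
    go zero    = Möbius-δ-∷ 0 s 0 a (0 ∷ s ∣ᵉ? 0 ∷ indicator a) (cong (0 ∷_))
    go (suc x) = trans (Möbius-∅ (λ b → suc x ∷ s ≟ᵉ 0 ∷ indicator b) (λ _ ()) a)
      (sym (𝟙-no (suc x ∷ s ∣ᵉ? 0 ∷ indicator a) λ ()))
  Möbius-δ (x ∷ s) (inside ∷ a) = trans (Möbius-inside (λ b → 𝟙[ x ∷ s ≟ᵉ indicator b ]) a) (go x)
    where
    go : ∀ x → Möbius (λ b → 𝟙[ x ∷ s ≟ᵉ 0 ∷ indicator b ]) a
                 +ℙ Möbius (λ b → 𝟙[ x ∷ s ≟ᵉ 1 ∷ indicator b ]) a
               ≡ 𝟙[ x ∷ s ∣ᵉ? 1 ∷ indicator a ]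
    go 0 = trans (cong₂ _+ℙ_
      (Möbius-δ-∷ 0 s 1 a (0 ∷ s ∣ᵉ? 1 ∷ indicator a) (cong (1 ∷_)))
      (Möbius-∅ (λ b → 0 ∷ s ≟ᵉ 1 ∷ indicator b) (λ _ ()) a))
      (Parity.+-identityʳ _)
    go 1 = cong₂ _+ℙ_
      (Möbius-∅ (λ b → 1 ∷ s ≟ᵉ 0 ∷ indicator b) (λ _ ()) a)
      (Möbius-δ-∷ 1 s 1 a (1 ∷ s ∣ᵉ? 1 ∷ indicator a) (cong (1 ∷_)))
    go (suc (suc x)) = trans (cong₂ _+ℙ_
      (Möbius-∅ (λ b → suc (suc x) ∷ s ≟ᵉ 0 ∷ indicator b) (λ _ ()) a)
      (Möbius-∅ (λ b → suc (suc x) ∷ s ≟ᵉ 1 ∷ indicator b) (λ _ ()) a))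
      (sym (𝟙-no (suc (suc x) ∷ s ∣ᵉ? 1 ∷ indicator a) λ ()))

  parity-filter : ∀ {A : Set} {P : A → Set} (P? : ∀ x → Dec (P x)) x xs →
    parity (length (filter P? (x ∷ xs))) ≡ 𝟙[ P? x ] +ℙ parity (length (filter P? xs))
  parity-filter P? x xs with does (P? x)
  ... | true  = sym (trans (cong _⁻¹ (sym (suc-homo-⁻¹ (length (filter P? xs))))) (⁻¹-involutive _))
  ... | false = refl

  -- The transform turns Betti numbers into the Hilbert function of the free module.
  Möbius-degrees : ∀ {J : Set} (s : J → Exponent m) js a →
    Möbius (λ b → parity (length (filter (λ j → s j ≟ᵉ indicator b) js))) a
      ≡ parity (length (filter (λ j → s j ∣ᵉ? indicator a) js))
  Möbius-degrees s []       a = Möbius-0 a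
  Möbius-degrees s (j ∷ js) a = begin
    Möbius (λ b → parity (length (filter (λ j → s j ≟ᵉ indicator b) (j ∷ js)))) a
      ≡⟨ Möbius-cong (λ b → parity-filter (λ j → s j ≟ᵉ indicator b) j js) a ⟩
    Möbius (λ b → 𝟙[ s j ≟ᵉ indicator b ]
      +ℙ parity (length (filter (λ j → s j ≟ᵉ indicator b) js))) a
      ≡⟨ Möbius-+ (λ b → 𝟙[ s j ≟ᵉ indicator b ]) _ a ⟩
    Möbius (λ b → 𝟙[ s j ≟ᵉ indicator b ]) a
      +ℙ Möbius (λ b → parity (length (filter (λ j → s j ≟ᵉ indicator b) js))) a
      ≡⟨ cong₂ _+ℙ_ (Möbius-δ (s j) a) (Möbius-degrees s js a) ⟩
    𝟙[ s j ∣ᵉ? indicator a ] +ℙ parity (length (filter (λ j → s j ∣ᵉ? indicator a) js))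
      ≡⟨ parity-filter (λ j → s j ∣ᵉ? indicator a) j js ⟨
    parity (length (filter (λ j → s j ∣ᵉ? indicator a) (j ∷ js))) ∎
    where open ≡-Reasoning

  Möbius-sum : ∀ {I : Set} {g h : I → Subset m → ℕ} →
    (∀ i a → Möbius (parity ∘ g i) a ≡ parity (h i a)) → ∀ is a →
    Möbius (λ b → parity (sum (map (λ i → g i b) is))) a ≡ parity (sum (map (λ i → h i a) is))
  Möbius-sum eq []       a = Möbius-0 a
  Möbius-sum {g = g} {h} eq (i ∷ is) a = begin
    Möbius (λ b → parity (g i b ℕ.+ sum (map (λ i → g i b) is))) a
      ≡⟨ Möbius-cong (λ b → +-homo-+ (g i b) (sum (map (λ i → g i b) is))) a ⟩
    Möbius (λ b → parity (g i b) +ℙ parity (sum (map (λ i → g i b) is))) a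
      ≡⟨ Möbius-+ (parity ∘ g i) (λ b → parity (sum (map (λ i → g i b) is))) a ⟩
    Möbius (parity ∘ g i) a +ℙ Möbius (λ b → parity (sum (map (λ i → g i b) is))) a
      ≡⟨ cong₂ _+ℙ_ (eq i a) (Möbius-sum {g = g} {h} eq is a) ⟩
    parity (h i a) +ℙ parity (sum (map (λ i → h i a) is))
      ≡⟨ +-homo-+ (h i a) (sum (map (λ i → h i a) is)) ⟨
    parity (h i a ℕ.+ sum (map (λ i → h i a) is)) ∎
    where open ≡-Reasoning

  -- Double sums and the count of odd values.

  sum-map-0 : ∀ {A : Set} (xs : List A) → sum (map (λ _ → 0) xs) ≡ 0
  sum-map-0 []       = refl
  sum-map-0 (x ∷ xs) = sum-map-0 xs

  sum-map-+ : ∀ {A : Set} (g h : A → ℕ) xs →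
    sum (map (λ x → g x ℕ.+ h x) xs) ≡ sum (map g xs) ℕ.+ sum (map h xs)
  sum-map-+ g h []       = refl
  sum-map-+ g h (x ∷ xs) = trans (cong (g x ℕ.+ h x ℕ.+_) (sum-map-+ g h xs))
    (ℕ+.interchange (g x) (h x) _ _)
    where import Algebra.Properties.CommutativeSemigroup ℕ.+-commutativeSemigroup as ℕ+

  sum-map-swap : ∀ {A B : Set} (g : A → B → ℕ) xs ys →
    sum (map (λ x → sum (map (g x) ys)) xs) ≡ sum (map (λ y → sum (map (λ x → g x y) xs)) ys)
  sum-map-swap g []       ys = sym (sum-map-0 ys)
  sum-map-swap g (x ∷ xs) ys = trans (cong (sum (map (g x) ys) ℕ.+_) (sum-map-swap g xs ys))
    (sym (sum-map-+ (g x) (λ y → sum (map (λ x → g x y) xs)) ys))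

  count-odd≤sum : ∀ {A : Set} (f : A → Parity) (g : A → ℕ) → (∀ x → f x ≡ parity (g x)) → ∀ xs →
    length (filter (λ x → f x Parity.≟ 1ℙ) xs) ≤ sum (map g xs)
  count-odd≤sum f g eq []       = z≤n
  count-odd≤sum f g eq (x ∷ xs) with f x in fx | g x in gx
  ... | 0ℙ | n     = ℕ.≤-trans (count-odd≤sum f g eq xs) (ℕ.m≤n+m _ n)
  ... | 1ℙ | suc n = s≤s (ℕ.≤-trans (count-odd≤sum f g eq xs) (ℕ.m≤n+m _ n))
  ... | 1ℙ | zero  = contradiction (trans (sym fx) (trans (eq x) (cong parity gx))) λ ()

open MöbiusTransform

private variable
  p q : Level
  A B : Set p

infixl 1 _>>=_
_>>=_ : DoubleNegation A → (A → DoubleNegation B) → DoubleNegation B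
(¬¬a >>= f) ¬b = ¬¬a λ a → f a ¬b

-- Linear algebra over a Heyting field: spans, elimination, dimension.

module LinearAlgebra {c ℓ₁ ℓ₂} (k : HeytingField c ℓ₁ ℓ₂) where
  open HeytingField k

  kᴿ : CommutativeRing c ℓ₁
  kᴿ = HeytingCommutativeRing.commutativeRing heytingCommutativeRing

  kring : Ring c ℓ₁
  kring = CommutativeRing.ring kᴿ

  open RingProperties kring using (-‿distribˡ-*; -0#≈0#)

  #0⇒inverse : ∀ {t} → t # 0# → ∃[ u ] u * t ≈ 1#
  #0⇒inverse {t} t#0 with u , ut≈1 , _ ← #⇒invertible t#0 =
    u , trans (*-congˡ (trans (sym (+-identityʳ t)) (+-congˡ (sym -0#≈0#)))) ut≈1

  -- Irreflexivity of apartness gives this: if 1 were 0, then 0 - 1 would equal the unit 1, and its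
  -- invertibility would make 0 apart from 1.
  1≉0 : ¬ 1# ≈ 0#
  1≉0 1≈0 = #-irrefl (sym 1≈0) (invertible⇒# (1# ,
    trans (*-identityˡ _) 0-1≈1 , trans (*-identityʳ _) 0-1≈1))
    where
    0-1≈1 : 0# - 1# ≈ 1#
    0-1≈1 = trans (+-congˡ (trans (-‿cong 1≈0) -0#≈0#)) (trans (+-identityˡ 0#) (sym 1≈0))

  -- Excluded middle is applied to `t # 0#`: tightness turns the negative answer into an equation,
  -- and the positive answer supplies the inverse that a pivot needs.
  ≈0⊎#0 : ∀ t → DoubleNegation (t ≈ 0# ⊎ t # 0#)
  ≈0⊎#0 t = ¬¬-map
    (λ { (yes t#0) → inj₂ t#0 ; (no ¬t#0) → inj₁ (proj₁ (tight t 0#) ¬t#0) })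
    ¬¬-excluded-middle

  -- Row reduction: `t` is the coordinate to clear, `g` the coordinate of the pivot and `h` its
  -- inverse.
  pivot-coeff : ∀ t {h g} → h * g ≈ 1# → - (t * h) * g + t ≈ 0#
  pivot-coeff t {h} {g} hg≈1 = trans (+-congʳ (trans (sym (-‿distribˡ-* (t * h) g))
    (-‿cong (trans (*-assoc t h g) (trans (*-congˡ hg≈1) (*-identityʳ t)))))) (-‿inverseˡ t)

  module Spans {m ℓm} (M : LeftModule kring m ℓm) where
    open LeftModule M
    open SetoidReasoning ≈ᴹ-setoid
    open CommutativeSemigroupProperties
      (CommutativeMonoid.commutativeSemigroup +ᴹ-commutativeMonoid)
      using (interchange)

    private variable
      n r : ℕ
      v x y : Carrierᴹ
      vs : Vec Carrierᴹ n

    -- A membership proof lists the coefficients one vector at a time, so that arguments recurse on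
    -- it instead of handling finite sums.
    data Span : ∀ {n} → Vec Carrierᴹ n → Pred Carrierᴹ (c ⊔ m ⊔ ℓm) where
      nil  : x ≈ᴹ 0ᴹ → Span [] x
      cons : ∀ t → Span vs y → x ≈ᴹ t *ₗ v +ᴹ y → Span (v ∷ vs) x

    -- This amounts to the usual independence: in a linear relation the first coefficient vanishes,
    -- then the next one, and so on.
    data Independent : ∀ {n} → Vec Carrierᴹ n → Set (c ⊔ ℓ₁ ⊔ m ⊔ ℓm) where
      []  : Independent []
      _∷_ : (∀ t → Span vs (t *ₗ v) → t ≈ 0#) → Independent vs → Independent (v ∷ vs)

    0*+ : ∀ v x → 0# *ₗ v +ᴹ x ≈ᴹ x
    0*+ v x = ≈ᴹ-trans (+ᴹ-congʳ (*ₗ-zeroˡ v)) (+ᴹ-identityˡ x)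

    span-resp : x ≈ᴹ y → Span vs x → Span vs y
    span-resp x≈y (nil x≈0)       = nil (≈ᴹ-trans (≈ᴹ-sym x≈y) x≈0)
    span-resp x≈y (cons t z∈ x≈z) = cons t z∈ (≈ᴹ-trans (≈ᴹ-sym x≈y) x≈z)

    span-∷ : Span vs x → Span (v ∷ vs) x
    span-∷ x∈ = cons 0# x∈ (≈ᴹ-sym (0*+ _ _))

    span-0 : ∀ (vs : Vec Carrierᴹ n) → Span vs 0ᴹ
    span-0 []       = nil ≈ᴹ-refl
    span-0 (v ∷ vs) = span-∷ (span-0 vs)

    span-head : Span (v ∷ vs) v
    span-head {v = v} {vs = vs} = cons 1# (span-0 vs)
      (≈ᴹ-sym (≈ᴹ-trans (+ᴹ-identityʳ _) (*ₗ-identityˡ v)))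

    span-+ : Span vs x → Span vs y → Span vs (x +ᴹ y)
    span-+ (nil x≈0) (nil y≈0) = nil (≈ᴹ-trans (+ᴹ-cong x≈0 y≈0) (+ᴹ-identityˡ 0ᴹ))
    span-+ {vs = v ∷ vs} {x = x} {y = y} (cons {y = x′} t x′∈ x≈) (cons {y = y′} s y′∈ y≈) =
      cons (t + s) (span-+ x′∈ y′∈) (begin
        x +ᴹ y                                   ≈⟨ +ᴹ-cong x≈ y≈ ⟩
        (t *ₗ v +ᴹ x′) +ᴹ (s *ₗ v +ᴹ y′)         ≈⟨ interchange _ _ _ _ ⟩
        (t *ₗ v +ᴹ s *ₗ v) +ᴹ (x′ +ᴹ y′)         ≈⟨ +ᴹ-congʳ (*ₗ-distribʳ v t s) ⟨
        (t + s) *ₗ v +ᴹ (x′ +ᴹ y′)               ∎)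

    span-* : ∀ s → Span vs x → Span vs (s *ₗ x)
    span-* s (nil x≈0) = nil (≈ᴹ-trans (*ₗ-congˡ x≈0) (*ₗ-zeroʳ s))
    span-* {vs = v ∷ vs} {x = x} s (cons {y = y} t y∈ x≈) = cons (s * t) (span-* s y∈) (begin
      s *ₗ x                       ≈⟨ *ₗ-congˡ x≈ ⟩
      s *ₗ (t *ₗ v +ᴹ y)           ≈⟨ *ₗ-distribˡ s _ _ ⟩
      s *ₗ t *ₗ v +ᴹ s *ₗ y        ≈⟨ +ᴹ-congʳ (*ₗ-assoc s t v) ⟨
      (s * t) *ₗ v +ᴹ s *ₗ y       ∎)

    *-cancel : ∀ {t u} → u * t ≈ 1# → ∀ x → u *ₗ t *ₗ x ≈ᴹ x
    *-cancel {t} {u} ut≈1 x = ≈ᴹ-trans (≈ᴹ-sym (*ₗ-assoc u t x))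
      (≈ᴹ-trans (*ₗ-congʳ ut≈1) (*ₗ-identityˡ x))

    *+-cancel : ∀ t x y → t *ₗ x +ᴹ ((- t) *ₗ x +ᴹ y) ≈ᴹ y
    *+-cancel t x y = begin
      t *ₗ x +ᴹ ((- t) *ₗ x +ᴹ y) ≈⟨ +ᴹ-assoc _ _ y ⟨
      (t *ₗ x +ᴹ (- t) *ₗ x) +ᴹ y ≈⟨ +ᴹ-congʳ (*ₗ-distribʳ x t (- t)) ⟨
      (t + - t) *ₗ x +ᴹ y         ≈⟨ +ᴹ-congʳ (*ₗ-congʳ (-‿inverseʳ t)) ⟩
      0# *ₗ x +ᴹ y                ≈⟨ 0*+ x y ⟩
      y                           ∎

    +*-cancel : ∀ t x y → (- t) *ₗ x +ᴹ (t *ₗ x +ᴹ y) ≈ᴹ y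
    +*-cancel t x y = begin
      (- t) *ₗ x +ᴹ (t *ₗ x +ᴹ y) ≈⟨ +ᴹ-assoc _ _ y ⟨
      ((- t) *ₗ x +ᴹ t *ₗ x) +ᴹ y ≈⟨ +ᴹ-congʳ (*ₗ-distribʳ x (- t) t) ⟨
      (- t + t) *ₗ x +ᴹ y         ≈⟨ +ᴹ-congʳ (*ₗ-congʳ (-‿inverseˡ t)) ⟩
      0# *ₗ x +ᴹ y                ≈⟨ 0*+ x y ⟩
      y                           ∎

    span-cancel : ∀ t → Span vs x → Span vs (t *ₗ x +ᴹ y) → Span vs y
    span-cancel {x = x} {y = y} t x∈ tx+y∈ =
      span-resp (+*-cancel t x y) (span-+ (span-* (- t) x∈) tx+y∈)

    -- If `t` were apart from 0, dividing by it would put `v` into the span; tightness then gives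
    -- `t ≈ 0#`.
    independent-∷ : ¬ Span vs v → Independent vs → Independent (v ∷ vs)
    independent-∷ {vs = vs} {v = v} v∉ ind = (λ t tv∈ → proj₁ (tight t 0#) λ t#0 →
      let u , ut≈1 = #0⇒inverse t#0 in v∉ (span-resp (*-cancel ut≈1 v) (span-* u tv∈))) ∷ ind

    head-coeff : Independent (v ∷ vs) → ∀ t → Span vs (t *ₗ v) → t ≈ 0#
    head-coeff (ind ∷ _) = ind

    head∉ : Independent (v ∷ vs) → ¬ Span vs v
    head∉ {v = v} iv v∈ = 1≉0 (head-coeff iv 1# (span-resp (≈ᴹ-sym (*ₗ-identityˡ v)) v∈))

    -- Either w does not occur at all, or a pivot z with invertible w-coordinate clears it.
    eliminate : ∀ w {ws : Vec Carrierᴹ r} {vs : Vec Carrierᴹ n} →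
      Independent vs → Span vs ⊆ Span (w ∷ ws) →
      DoubleNegation (∃[ n′ ] ∃[ us ] Independent {n′} us × Span us ⊆ Span ws × n ≤ suc n′)
    eliminate {r} w {ws} ind vs⊆ = ¬¬-map (finish ind) (go ind vs⊆)
      where
      Pivot : Vec Carrierᴹ n → Set _
      Pivot {n} vs = ∃[ z ] ∃[ g ] ∃[ u ] Span vs z × g # 0# × Span ws u × z ≈ᴹ g *ₗ w +ᴹ u ×
        (∃[ n′ ] ∃[ us ] Independent {n′} us × Span us ⊆ Span vs × Span us ⊆ Span ws × n ≤ suc n′)

      finish : ∀ {n} {vs : Vec Carrierᴹ n} → Independent vs → Span vs ⊆ Span ws ⊎ Pivot vs →
        -- `us` is the family after clearing and dropping the pivot. Its inclusion in `Span vs` is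
        -- carried along to show that the next cleared vector is independent of it.
        ∃[ n′ ] ∃[ us ] Independent {n′} us × Span us ⊆ Span ws × n ≤ suc n′
      finish ind (inj₁ vs⊆ws) = _ , _ , ind , (λ {_} → vs⊆ws) , ℕ.n≤1+n _
      finish ind (inj₂ (_ , _ , _ , _ , _ , _ , _ , n′ , us , ind′ , _ , us⊆ , n≤)) =
        n′ , us , ind′ , (λ {_} → us⊆) , n≤

      go : Independent vs → Span {n} vs ⊆ Span (w ∷ ws) →
        DoubleNegation (Span vs ⊆ Span ws ⊎ Pivot vs)
      go {vs = []}     []           vs⊆ ¬p = ¬p (inj₁ λ where
        (nil x≈0) → span-resp (≈ᴹ-sym x≈0) (span-0 ws))
      go {vs = v ∷ vs} iv@(_ ∷ ind) vs⊆ with vs⊆ span-head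
      ... | cons {y = u} t u∈ v≈ = go ind (λ x∈ → vs⊆ (span-∷ x∈)) >>= λ where
        (inj₁ vs⊆ws) → ≈0⊎#0 t >>= λ where
          (inj₁ t≈0) ¬p → ¬p (inj₁ λ where
            (cons s y∈ x≈) → span-resp (≈ᴹ-sym x≈) (span-+
              (span-* s (span-resp
                (≈ᴹ-sym (≈ᴹ-trans v≈ (≈ᴹ-trans (+ᴹ-congʳ (*ₗ-congʳ t≈0)) (0*+ w u)))) u∈))
              (vs⊆ws y∈)))
          -- The tail does not involve `w`, so `v` becomes the pivot and the tail is kept unchanged.
          (inj₂ t#0) ¬p → ¬p (inj₂ (v , t , u , span-head , t#0 , u∈ , v≈ ,
            _ , vs , ind , (λ {_} → span-∷) , (λ {_} → vs⊆ws) , ℕ.≤-refl))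
        (inj₂ (z , g , u′ , z∈ , g#0 , u′∈ , z≈ , n′ , us , ind′ , us⊆vs , us⊆ws , n≤)) ¬p →
          let h , hg≈1 = #0⇒inverse g#0
              s = - (t * h)
              v′ = s *ₗ z +ᴹ v
              v∈⇒ : Span vs v′ → Span vs v
              v∈⇒ = span-cancel s z∈
              v′∈ws : Span ws v′
              v′∈ws = span-resp (begin
                s *ₗ u′ +ᴹ u                                ≈⟨ 0*+ w _ ⟨
                0# *ₗ w +ᴹ (s *ₗ u′ +ᴹ u)                   ≈⟨ +ᴹ-congʳ (*ₗ-congʳ (pivot-coeff t hg≈1)) ⟨
                (s * g + t) *ₗ w +ᴹ (s *ₗ u′ +ᴹ u)          ≈⟨ +ᴹ-congʳ (*ₗ-distribʳ w (s * g) t) ⟩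
                ((s * g) *ₗ w +ᴹ t *ₗ w) +ᴹ (s *ₗ u′ +ᴹ u)  ≈⟨ interchange _ _ _ _ ⟩
                ((s * g) *ₗ w +ᴹ s *ₗ u′) +ᴹ (t *ₗ w +ᴹ u)  ≈⟨ +ᴹ-congʳ (+ᴹ-congʳ (*ₗ-assoc s g w)) ⟩
                (s *ₗ g *ₗ w +ᴹ s *ₗ u′) +ᴹ (t *ₗ w +ᴹ u)   ≈⟨ +ᴹ-congʳ (*ₗ-distribˡ s _ _) ⟨
                s *ₗ (g *ₗ w +ᴹ u′) +ᴹ (t *ₗ w +ᴹ u)        ≈⟨ +ᴹ-cong (*ₗ-congˡ z≈) v≈ ⟨
                s *ₗ z +ᴹ v                                 ∎)
                (span-+ (span-* s u′∈) u∈)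
              v′∈ : Span (v ∷ vs) v′
              v′∈ = span-+ (span-* s (span-∷ z∈)) span-head
          in ¬p (inj₂ (z , g , u′ , span-∷ z∈ , g#0 , u′∈ , z≈ , suc n′ , v′ ∷ us ,
             independent-∷ (λ v′∈us → head∉ iv (v∈⇒ (us⊆vs v′∈us))) ind′ ,
             (λ { (cons a y∈ x≈) →
                  span-resp (≈ᴹ-sym x≈) (span-+ (span-* a v′∈) (span-∷ (us⊆vs y∈))) }) ,
             (λ { (cons a y∈ x≈) →
                  span-resp (≈ᴹ-sym x≈) (span-+ (span-* a v′∈ws) (us⊆ws y∈)) }) ,
             s≤s n≤))

    -- Steinitz by induction on the spanning family: removing one generator by `eliminate` costs at
    -- most one independent vector.
    independent-≤ : ∀ {vs : Vec Carrierᴹ n} {ws : Vec Carrierᴹ r} →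
      Independent vs → Span vs ⊆ Span ws → DoubleNegation (n ≤ r)
    independent-≤ {vs = []}     {ws}     ind vs⊆ ¬p = ¬p z≤n
    independent-≤ {vs = v ∷ vs} {[]}     ind vs⊆ ¬p with vs⊆ span-head
    ... | nil v≈0 = head∉ ind (span-resp (≈ᴹ-sym v≈0) (span-0 vs))
    independent-≤ {vs = v ∷ vs} {w ∷ ws} ind vs⊆ =
      eliminate w ind vs⊆ >>= λ (_ , us , ind′ , us⊆ , n≤) →
      ¬¬-map (λ n′≤ → ℕ.≤-trans n≤ (s≤s n′≤)) (independent-≤ ind′ us⊆)

    dimension-unique : ∀ {vs : Vec Carrierᴹ n} {ws : Vec Carrierᴹ r} →
      Independent vs → Independent ws → Span vs ≐ Span ws → n ≡ r
    dimension-unique {n} {r} iv iw (vs⊆ws , ws⊆vs) = decidable-stable (n ℕ.≟ r)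
      (independent-≤ iv vs⊆ws >>= λ n≤r → ¬¬-map (ℕ.≤-antisym n≤r) (independent-≤ iw ws⊆vs))

    -- A subspace is a bare predicate, so kernels, images and homogeneous parts need no module
    -- structure of their own.
    record Basis {p} (U : Pred Carrierᴹ p) (n : ℕ) : Set (c ⊔ ℓ₁ ⊔ m ⊔ ℓm ⊔ p) where
      constructor basis
      field
        {vectors}   : Vec Carrierᴹ n
        independent : Independent vectors
        spans       : Span vectors ≐ U

    Basis-unique : ∀ {U : Pred Carrierᴹ p} {V : Pred Carrierᴹ q} →
      Basis U n → Basis V r → U ≐ V → n ≡ r
    Basis-unique (basis iv (v⊆U , U⊆v)) (basis iw (w⊆V , V⊆w)) (U⊆V , V⊆U) =
      dimension-unique iv iw ((λ x∈ → V⊆w (U⊆V (v⊆U x∈))) , (λ x∈ → U⊆v (V⊆U (w⊆V x∈))))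

    Basis-resp : ∀ {U : Pred Carrierᴹ p} {V : Pred Carrierᴹ q} → U ≐ V → Basis U n → Basis V n
    Basis-resp (U⊆V , V⊆U) (basis iv (v⊆U , U⊆v)) =
      basis iv ((λ x∈ → U⊆V (v⊆U x∈)) , (λ x∈ → U⊆v (V⊆U x∈)))

  -- Linear maps: rank-nullity and images under injections.

  module _ {m ℓm m′ ℓm′} {M : LeftModule kring m ℓm} {N : LeftModule kring m′ ℓm′}
           {φ : LeftModule.Carrierᴹ M → LeftModule.Carrierᴹ N}
           (φ-hom : LeftModuleMorphisms.IsLeftModuleHomomorphism
                      (LeftModule.rawLeftModule M) (LeftModule.rawLeftModule N) φ) where
    open LeftModuleMorphisms.IsLeftModuleHomomorphism φ-hom
    private
      module M = LeftModule M
      module N = LeftModule N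
      module SM = Spans M
      module SN = Spans N
    open SM using (Basis; basis)
    open LeftModule N using
      (_≈ᴹ_; ≈ᴹ-trans; ≈ᴹ-sym; ≈ᴹ-refl; 0ᴹ; +ᴹ-cong; +ᴹ-congˡ; +ᴹ-congʳ; *ₗ-congˡ)

    Kernel : Pred M.Carrierᴹ p → Pred M.Carrierᴹ (p ⊔ ℓm′)
    Kernel U x = U x × φ x ≈ᴹ 0ᴹ

    Image : Pred M.Carrierᴹ p → Pred N.Carrierᴹ _
    Image U y = ∃[ x ] U x × φ x ≈ᴹ y

    φ-+* : ∀ t x y → φ (t M.*ₗ x M.+ᴹ y) ≈ᴹ t N.*ₗ φ x N.+ᴹ φ y
    φ-+* t x y = ≈ᴹ-trans (+ᴹ-homo _ y) (+ᴹ-congʳ (*ₗ-homo t x))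

    RankNullity : Pred M.Carrierᴹ p → ℕ → Set _
    RankNullity U n = ∃[ r ] ∃[ s ] Basis (Kernel U) r × SN.Basis (Image U) s × r ℕ.+ s ≡ n

    private
      -- Each further basis vector `v` enlarges exactly one of the two bases. If `φ v` equals `φ z`
      -- for some `z` in the span of the earlier vectors, then `v - z` is a new kernel vector;
      -- otherwise `φ v` is a new image vector. Excluded middle makes the choice.
      rank-nullity-span : ∀ {n} {vs : Vec M.Carrierᴹ n} → SM.Independent vs →
        DoubleNegation (RankNullity (SM.Span vs) n)
      rank-nullity-span {vs = []} SM.[] ¬p = ¬p (0 , 0 ,
        basis SM.[] ((λ { (SM.nil x≈0) → SM.nil x≈0 , ≈ᴹ-trans (⟦⟧-cong x≈0) 0ᴹ-homo }) , proj₁) ,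
        SN.basis SN.[]
          ((λ { (SN.nil y≈0) → M.0ᴹ , SM.nil M.≈ᴹ-refl , ≈ᴹ-trans 0ᴹ-homo (≈ᴹ-sym y≈0) }) ,
           (λ { (x , SM.nil x≈0 , φx≈y) →
                    SN.nil (≈ᴹ-trans (≈ᴹ-sym φx≈y) (≈ᴹ-trans (⟦⟧-cong x≈0) 0ᴹ-homo)) })) ,
        ≡.refl)
      rank-nullity-span {vs = v ∷ vs} iv@(_ SM.∷ ind) = rank-nullity-span ind >>=
        λ (r , s , basis {ks} ik (k⊆ , ⊆k) , SN.basis {is} ii (i⊆ , ⊆i) , r+s≡n) → ¬¬-map (λ where
          (yes (z , z∈ , φz≈φv)) →
            let open SetoidReasoning N.≈ᴹ-setoid
                v′ = (- 1#) M.*ₗ z M.+ᴹ v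
                φv′≈0 : φ v′ ≈ᴹ 0ᴹ
                φv′≈0 = begin
                  φ v′                       ≈⟨ φ-+* (- 1#) z v ⟩
                  (- 1#) N.*ₗ φ z N.+ᴹ φ v
                    ≈⟨ +ᴹ-cong (*ₗ-congˡ φz≈φv) (≈ᴹ-trans (≈ᴹ-sym (N.*ₗ-identityˡ (φ v)))
                         (≈ᴹ-sym (N.+ᴹ-identityʳ _))) ⟩
                  (- 1#) N.*ₗ φ v N.+ᴹ (1# N.*ₗ φ v N.+ᴹ 0ᴹ) ≈⟨ SN.+*-cancel 1# (φ v) 0ᴹ ⟩
                  0ᴹ ∎
                v′∈ : SM.Span (v ∷ vs) v′
                v′∈ = SM.span-+ (SM.span-* (- 1#) (SM.span-∷ z∈)) SM.span-head
            in suc r , s ,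
              basis (SM.independent-∷
                  (λ v′∈ks → SM.head∉ iv (SM.span-cancel (- 1#) z∈ (proj₁ (k⊆ v′∈ks)))) ik)
                ( (λ { {x} (SM.cons {y = y} t y∈ x≈) → let y∈vs , φy≈0 = k⊆ y∈ in
                       SM.span-resp (M.≈ᴹ-sym x≈) (SM.span-+ (SM.span-* t v′∈) (SM.span-∷ y∈vs)) ,
                       (begin
                         φ x                         ≈⟨ ⟦⟧-cong x≈ ⟩
                         φ (t M.*ₗ v′ M.+ᴹ y)        ≈⟨ φ-+* t v′ y ⟩
                         t N.*ₗ φ v′ N.+ᴹ φ y        ≈⟨ +ᴹ-cong (*ₗ-congˡ φv′≈0) φy≈0 ⟩
                         t N.*ₗ 0ᴹ N.+ᴹ 0ᴹ           ≈⟨ N.+ᴹ-identityʳ _ ⟩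
                         t N.*ₗ 0ᴹ                   ≈⟨ N.*ₗ-zeroʳ t ⟩
                         0ᴹ                          ∎) })
                , (λ { {x} (SM.cons {y = y} t y∈ x≈ , φx≈0) →
                       SM.cons t (⊆k (SM.span-+ (SM.span-* t z∈) y∈ , (begin
                         φ (t M.*ₗ z M.+ᴹ y)         ≈⟨ φ-+* t z y ⟩
                         t N.*ₗ φ z N.+ᴹ φ y         ≈⟨ +ᴹ-congʳ (*ₗ-congˡ φz≈φv) ⟩
                         t N.*ₗ φ v N.+ᴹ φ y         ≈⟨ φ-+* t v y ⟨
                         φ (t M.*ₗ v M.+ᴹ y)         ≈⟨ ⟦⟧-cong x≈ ⟨
                         φ x                         ≈⟨ φx≈0 ⟩
                         0ᴹ                          ∎))) (rebase t z v y x≈) })) ,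
              SN.basis ii
                ( (λ y∈ → let x , x∈ , φx≈y = i⊆ y∈ in x , SM.span-∷ x∈ , φx≈y)
                , (λ { {y} (x , SM.cons {y = x′} t x′∈ x≈ , φx≈y) →
                       ⊆i (t M.*ₗ z M.+ᴹ x′ , SM.span-+ (SM.span-* t z∈) x′∈ , (begin
                         φ (t M.*ₗ z M.+ᴹ x′)        ≈⟨ φ-+* t z x′ ⟩
                         t N.*ₗ φ z N.+ᴹ φ x′        ≈⟨ +ᴹ-congʳ (*ₗ-congˡ φz≈φv) ⟩
                         t N.*ₗ φ v N.+ᴹ φ x′        ≈⟨ φ-+* t v x′ ⟨
                         φ (t M.*ₗ v M.+ᴹ x′)        ≈⟨ ⟦⟧-cong x≈ ⟨
                         φ x                         ≈⟨ φx≈y ⟩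
                         y                           ∎)) })) ,
              ≡.cong suc r+s≡n
          (no φv∉) →
            let open SetoidReasoning N.≈ᴹ-setoid
                φv∷is = SN.independent-∷ (λ φv∈ → φv∉ (i⊆ φv∈)) ii
                -- The relation says that `t` times `φ v` is the image of `-y`, hence lies in the
                -- span of `is`, which is independent of `φ v`.
                t≈0 : ∀ t y → SM.Span vs y → t N.*ₗ φ v N.+ᴹ φ y ≈ᴹ 0ᴹ → t ≈ 0#
                t≈0 t y y∈ eq = SN.head-coeff φv∷is t (SN.span-resp
                  (begin
                    φ ((- 1#) M.*ₗ y)          ≈⟨ *ₗ-homo (- 1#) y ⟩
                    (- 1#) N.*ₗ φ y            ≈⟨ N.+ᴹ-identityʳ _ ⟨
                    (- 1#) N.*ₗ φ y N.+ᴹ 0ᴹ    ≈⟨ +ᴹ-congˡ eq ⟨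
                    (- 1#) N.*ₗ φ y N.+ᴹ (t N.*ₗ φ v N.+ᴹ φ y)
                      ≈⟨ +ᴹ-congˡ (≈ᴹ-trans (N.+ᴹ-comm _ _) (+ᴹ-congʳ (≈ᴹ-sym (N.*ₗ-identityˡ (φ y))))) ⟩
                    (- 1#) N.*ₗ φ y N.+ᴹ (1# N.*ₗ φ y N.+ᴹ t N.*ₗ φ v)
                      ≈⟨ SN.+*-cancel 1# (φ y) _ ⟩
                    t N.*ₗ φ v ∎)
                  (⊆i ((- 1#) M.*ₗ y , SM.span-* (- 1#) y∈ , ≈ᴹ-refl)))
            in r , suc s ,
              basis ik
                ( (λ x∈ → let x∈vs , φx≈0 = k⊆ x∈ in SM.span-∷ x∈vs , φx≈0)
                , (λ { {x} (SM.cons {y = y} t y∈ x≈ , φx≈0) →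
                       let eq = t≈0 t y y∈ (≈ᴹ-trans (≈ᴹ-sym (φ-+* t v y))
                                  (≈ᴹ-trans (≈ᴹ-sym (⟦⟧-cong x≈)) φx≈0))
                           x≈y = M.≈ᴹ-trans x≈ (M.≈ᴹ-trans (M.+ᴹ-congʳ (M.*ₗ-congʳ eq)) (SM.0*+ v y))
                       in ⊆k (SM.span-resp (M.≈ᴹ-sym x≈y) y∈ , φx≈0) })) ,
              SN.basis φv∷is
                ( (λ { {y} (SN.cons {y = y′} t y′∈ y≈) → let x , x∈ , φx≈y′ = i⊆ y′∈ in
                       t M.*ₗ v M.+ᴹ x , SM.cons t x∈ M.≈ᴹ-refl ,
                       ≈ᴹ-trans (φ-+* t v x) (≈ᴹ-trans (+ᴹ-congˡ φx≈y′) (≈ᴹ-sym y≈)) })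
                , (λ { {y} (x , SM.cons {y = x′} t x′∈ x≈ , φx≈y) →
                       SN.cons t (⊆i (x′ , x′∈ , ≈ᴹ-refl))
                         (≈ᴹ-trans (≈ᴹ-sym φx≈y) (≈ᴹ-trans (⟦⟧-cong x≈) (φ-+* t v x′))) })) ,
              ≡.trans (ℕ.+-suc r s) (≡.cong suc r+s≡n))
        (¬¬-excluded-middle {A = Image (SM.Span vs) (φ v)})
        where
        -- The exchange of the basis vector `v` for `v - z`.
        rebase : ∀ {x} t z v y → x M.≈ᴹ t M.*ₗ v M.+ᴹ y →
          x M.≈ᴹ t M.*ₗ ((- 1#) M.*ₗ z M.+ᴹ v) M.+ᴹ (t M.*ₗ z M.+ᴹ y)
        rebase {x} t z v y x≈ = begin
          x                                                       ≈⟨ x≈ ⟩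
          t M.*ₗ v M.+ᴹ y                                         ≈⟨ M.+ᴹ-congʳ (M.*ₗ-congˡ (SM.+*-cancel 1# z v)) ⟨
          t M.*ₗ ((- 1#) M.*ₗ z M.+ᴹ (1# M.*ₗ z M.+ᴹ v)) M.+ᴹ y
            ≈⟨ M.+ᴹ-congʳ (M.*ₗ-congˡ (M.≈ᴹ-trans
                 (M.+ᴹ-congˡ (M.≈ᴹ-trans (M.+ᴹ-comm _ v) (M.+ᴹ-congˡ (M.*ₗ-identityˡ z))))
                 (M.≈ᴹ-sym (M.+ᴹ-assoc _ v z)))) ⟩
          t M.*ₗ (((- 1#) M.*ₗ z M.+ᴹ v) M.+ᴹ z) M.+ᴹ y           ≈⟨ M.+ᴹ-congʳ (M.*ₗ-distribˡ t _ z) ⟩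
          (t M.*ₗ ((- 1#) M.*ₗ z M.+ᴹ v) M.+ᴹ t M.*ₗ z) M.+ᴹ y    ≈⟨ M.+ᴹ-assoc _ _ y ⟩
          t M.*ₗ ((- 1#) M.*ₗ z M.+ᴹ v) M.+ᴹ (t M.*ₗ z M.+ᴹ y)    ∎
          where open SetoidReasoning M.≈ᴹ-setoid

    rank-nullity : ∀ {U : Pred M.Carrierᴹ p} {n} → Basis U n → DoubleNegation (RankNullity U n)
    rank-nullity {U = U} (basis iv (v⊆ , ⊆v)) = ¬¬-map (λ (r , s , bk , bi , eq) → r , s ,
      SM.Basis-resp ((λ (x∈ , φx≈0) → v⊆ x∈ , φx≈0) , (λ (x∈ , φx≈0) → ⊆v x∈ , φx≈0)) bk ,
      SN.Basis-resp
        ((λ (x , x∈ , φx≈y) → x , v⊆ x∈ , φx≈y) , (λ (x , x∈ , φx≈y) → x , ⊆v x∈ , φx≈y)) bi ,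
      eq) (rank-nullity-span iv)

    module _ (injective : ∀ {x y} → φ x ≈ᴹ φ y → x M.≈ᴹ y) where

      span-map : ∀ {n} (vs : Vec M.Carrierᴹ n) {y} →
        SN.Span (Vec.map φ vs) y → Image (SM.Span vs) y
      span-map []       (SN.nil y≈0) = M.0ᴹ , SM.nil M.≈ᴹ-refl , ≈ᴹ-trans 0ᴹ-homo (≈ᴹ-sym y≈0)
      span-map (v ∷ vs) (SN.cons t z∈ y≈) with x , x∈ , φx≈z ← span-map vs z∈ =
        t M.*ₗ v M.+ᴹ x , SM.cons t x∈ M.≈ᴹ-refl ,
        ≈ᴹ-trans (φ-+* t v x) (≈ᴹ-trans (+ᴹ-congˡ φx≈z) (≈ᴹ-sym y≈))

      map-span : ∀ {n} {vs : Vec M.Carrierᴹ n} {x} → SM.Span vs x → SN.Span (Vec.map φ vs) (φ x)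
      map-span (SM.nil x≈0)       = SN.nil (≈ᴹ-trans (⟦⟧-cong x≈0) 0ᴹ-homo)
      map-span (SM.cons t y∈ x≈) = SN.cons t (map-span y∈) (≈ᴹ-trans (⟦⟧-cong x≈) (φ-+* t _ _))

      independent-map : ∀ {n} {vs : Vec M.Carrierᴹ n} →
        SM.Independent vs → SN.Independent (Vec.map φ vs)
      independent-map SM.[] = SN.[]
      independent-map {vs = v ∷ vs} (i SM.∷ ind) =
        (λ t t∈ → let x , x∈ , φx≈ = span-map vs t∈ in
          i t (SM.span-resp (injective (≈ᴹ-trans φx≈ (≈ᴹ-sym (*ₗ-homo t v)))) x∈))
        SN.∷ independent-map ind

      Basis-image : ∀ {U : Pred M.Carrierᴹ p} {n} → Basis U n → SN.Basis (Image U) n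
      Basis-image (basis {vs} ind (v⊆ , ⊆v)) = SN.basis (independent-map ind)
        ( (λ y∈ → let x , x∈ , φx≈y = span-map vs y∈ in x , v⊆ x∈ , φx≈y)
        , (λ (x , x∈ , φx≈y) → SN.span-resp φx≈y (map-span (⊆v x∈))))

-- Multigraded free modules over the polynomial ring.

indicator-⊆ : ∀ {m} (b : Exponent m) (τ a : Subset m) →
  b +ᵉ indicator τ ≡ indicator a → τ Subset.⊆ a
indicator-⊆ (zero ∷ b)  (inside ∷ τ) (inside ∷ a) eq here = here
indicator-⊆ (suc x ∷ b) (inside ∷ τ) (inside ∷ a) eq here = here
indicator-⊆ (zero ∷ b)  (inside ∷ τ) (outside ∷ a) () here
indicator-⊆ (suc x ∷ b) (inside ∷ τ) (outside ∷ a) () here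
indicator-⊆ (x ∷ b)     (_ ∷ τ)      (_ ∷ a)       eq (there i∈) =
  there (indicator-⊆ b τ a (Vec.∷-injectiveʳ eq) i∈)

module Graded {c ℓ₁ ℓ₂} (k : HeytingField c ℓ₁ ℓ₂) (m : ℕ) where
  open LinearAlgebra k
  open CommutativeRing kᴿ hiding (zero)
  open Polynomials kᴿ m
  open FaceRings k m
  open Ideals polynomialRing using (⟨_⟩; congruent)
  open ⟨_⟩
  open AbelianGroupProperties +-abelianGroup using (x∙y⁻¹≈ε⇒x≈y)
  private module P = CommutativeRing polynomialRing

  0#-+ : ∀ {x y} → x ≈ 0# → x + y ≈ y
  0#-+ x≈0 = trans (+-congʳ x≈0) (+-identityˡ _)

  *0# : ∀ t {x} → x ≈ 0# → t * x ≈ 0#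
  *0# t x≈0 = trans (*-congˡ x≈0) (zeroʳ t)

  δ-refl : ∀ b → δ b b ≈ 1#
  δ-refl b with b ≟ᵉ b
  ... | yes _  = refl
  ... | no b≢b = contradiction ≡.refl b≢b

  δ-≢ : ∀ a b → a ≢ b → δ a b ≈ 0#
  δ-≢ a b a≢b with a ≟ᵉ b
  ... | yes a≡b = contradiction a≡b a≢b
  ... | no  _   = refl

  coeff-term-≢ : ∀ t b b′ → b′ ≢ b → coeff List.[ t , b ] b′ ≈ 0#
  coeff-term-≢ t b b′ b′≢b = trans (+-identityʳ _) (*0# t (δ-≢ b′ b b′≢b))

  coeff-term-refl : ∀ t b → coeff List.[ t , b ] b ≈ t
  coeff-term-refl t b = trans (+-identityʳ _) (trans (*-congˡ (δ-refl b)) (*-identityʳ t))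

  coeff-+ : ∀ p q b → coeff (p +ᵖ q) b ≈ coeff p b + coeff q b
  coeff-+ p q b = linear-++ (δ b) p q

  scalar : Carrier → Polynomial
  scalar t = List.[ t , 0ᵉ ]

  scalar-cong : ∀ {s t} → s ≈ t → scalar s ≈ᵖ scalar t
  scalar-cong s≈t .at a = +-congʳ (*-congʳ s≈t)

  scalar-0 : scalar 0# ≈ᵖ []
  scalar-0 .at a = trans (+-identityʳ _) (zeroˡ _)

  scalar-+ : ∀ s t → scalar (s + t) ≈ᵖ scalar s +ᵖ scalar t
  scalar-+ s t .at a = trans (+-congʳ (distribʳ _ s t)) (+-assoc _ _ 0#)

  scalar-* : ∀ s t → scalar (s * t) ≈ᵖ scalar s *ᵖ scalar t
  scalar-* s t .at a = reflexive
    (≡.cong (λ b → coeff List.[ s * t , b ] a) (≡.sym (+ᵉ-identityˡ 0ᵉ)))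

  coeff-scalar-* : ∀ t p b → coeff (scalar t *ᵖ p) b ≈ t * coeff p b
  coeff-scalar-* t p b = trans (linear-product (δ b) (scalar t) p) (trans (+-identityʳ _)
    (*-congˡ (linear-cong p λ c → reflexive (≡.cong (δ b) (+ᵉ-identityˡ c)))))

  -- Each multidegree of k[v] contains a single monomial, so its homogeneous part is a line. This is
  -- what turns dimensions of strands into counts of generators.
  homogeneous-multiple : ∀ {e p} → Homogeneous e p → p ≈ᵖ scalar (coeff p e) *ᵖ monomial e
  homogeneous-multiple {e} {p} p-hom .at b with b ≟ᵉ e
  ... | yes ≡.refl = sym (trans (coeff-scalar-* (coeff p e) (monomial e) e)
                       (trans (*-congˡ (coeff-term-refl 1# e)) (*-identityʳ _)))
  ... | no b≢e     = trans (p-hom b b≢e) (sym (trans (coeff-scalar-* (coeff p e) (monomial e) b)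
                       (*0# _ (coeff-term-≢ 1# e b b≢e))))

  -- Restriction of scalars to the constants: a strand is closed under these but not under
  -- multiplication by the variables.
  restrict : ∀ {p ℓ} → Module polynomialRing p ℓ → LeftModule kring p ℓ
  restrict M = record
    { Carrierᴹ = Carrierᴹ
    ; _*ₗ_ = λ t x → scalar t *ₗ x
    ; isLeftModule = record
      { isLeftSemimodule = record
        { +ᴹ-isCommutativeMonoid = +ᴹ-isCommutativeMonoid
        ; isPreleftSemimodule = record
          { *ₗ-cong = λ s≈t → *ₗ-cong (scalar-cong s≈t)
          ; *ₗ-zeroˡ = λ x → ≈ᴹ-trans (*ₗ-congʳ scalar-0) (*ₗ-zeroˡ x)
          ; *ₗ-distribʳ = λ x s t →
              ≈ᴹ-trans (*ₗ-congʳ (scalar-+ s t)) (*ₗ-distribʳ x (scalar s) (scalar t))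
          ; *ₗ-identityˡ = *ₗ-identityˡ
          ; *ₗ-assoc = λ s t x →
              ≈ᴹ-trans (*ₗ-congʳ (scalar-* s t)) (*ₗ-assoc (scalar s) (scalar t) x)
          ; *ₗ-zeroʳ = λ s → *ₗ-zeroʳ (scalar s)
          ; *ₗ-distribˡ = λ s → *ₗ-distribˡ (scalar s)
          }
        }
      ; -ᴹ‿cong = -ᴹ‿cong
      ; -ᴹ‿inverse = -ᴹ‿inverse
      }
    }
    where open Module M

  restrict-hom : ∀ {p ℓ p′ ℓ′}
    {M : Module polynomialRing p ℓ} {N : Module polynomialRing p′ ℓ′} {φ} →
    ModuleMorphisms.IsModuleHomomorphism (Module.rawModule M) (Module.rawModule N) φ →
    LeftModuleMorphisms.IsLeftModuleHomomorphism
      (LeftModule.rawLeftModule (restrict M)) (LeftModule.rawLeftModule (restrict N)) φ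
  restrict-hom φ-hom = record
    { +ᴹ-isGroupHomomorphism = +ᴹ-isGroupHomomorphism
    ; *ₗ-homo = λ t → *ₗ-homo (scalar t)
    }
    where open ModuleMorphisms.IsModuleHomomorphism φ-hom

  ⨁ : ℕ → LeftModule kring c ℓ₁
  ⨁ n = restrict (freeModule polynomialRing n)
  private module ⨁ n = LeftModule (⨁ n)

  infixr 5 _∷⨁_
  _∷⨁_ : ∀ {n} → Polynomial → (Fin n → Polynomial) → Fin (suc n) → Polynomial
  (p ∷⨁ x) zero    = p
  (p ∷⨁ x) (suc j) = x j

  0∷-hom : ∀ {n} → LeftModuleMorphisms.IsLeftModuleHomomorphism
    (⨁.rawLeftModule n) (⨁.rawLeftModule (suc n)) ([] ∷⨁_)
  0∷-hom = record
    { +ᴹ-isGroupHomomorphism = record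
      { isMonoidHomomorphism = record
        { isMagmaHomomorphism = record
          { isRelHomomorphism = record { cong = λ { x≈y zero → P.refl ; x≈y (suc j) → x≈y j } }
          ; homo = λ { x y zero → P.refl ; x y (suc j) → P.refl }
          }
        ; ε-homo = λ { zero → P.refl ; (suc j) → P.refl }
        }
      ; ⁻¹-homo = λ { x zero → P.refl ; x (suc j) → P.refl }
      }
    ; *ₗ-homo = λ { t x zero → P.refl ; t x (suc j) → P.refl }
    }

  +ᵉ⇒∸ᵉ : ∀ {n} {s b e : Exponent n} → s +ᵉ b ≡ e → b ≡ Vec.zipWith ℕ._∸_ e s
  +ᵉ⇒∸ᵉ {s = s} {b} ≡.refl = ≡.sym (+ᵉ-∸ᵉ s b)

  -- The basis consists of v^(e - s j) in coordinate j, one vector for each `s j` dividing `e`. The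
  -- indices pass through `f` because the tail of `allFin (suc n)` is a tabulation of `suc` and not
  -- itself of the form `allFin`.
  homogeneous-basis : ∀ {J : Set} (s : J → Exponent m) e {n} (f : Fin n → J) →
    Spans.Basis (⨁ n) (Homogeneous-⨁ (s ∘ f) e) (length (filter (λ j → s j ∣ᵉ? e) (tabulate f)))
  homogeneous-basis s e {zero}  f = basis [] ((λ _ ()) , (λ _ → nil λ ()))
    where open Spans (⨁ 0)
  homogeneous-basis s e {suc n} f with s (f zero) ∣ᵉ? e
  ... | no ∤e = Basis-resp
    ( (λ { (x , x-hom , x≈y) zero b eq → sym (at (x≈y zero) b)
         ; (x , x-hom , x≈y) (suc j) b eq → trans (sym (at (x≈y (suc j)) b)) (x-hom j b eq) })
    , (λ {y} y-hom → y ∘ suc , (λ j → y-hom (suc j)) ,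
         -- As `s (f zero)` does not divide `e`, no exponent `b` completes it to `e`, and
         -- homogeneity forces the head to vanish.
         λ { zero → coefficientwise (λ b → sym (y-hom zero b
               λ eq → ∤e (≡.subst (λ b → s (f zero) +ᵉ b ≡ e) (+ᵉ⇒∸ᵉ eq) eq)))
           ; (suc j) → P.refl }))
    (Basis-image 0∷-hom (λ x≈y j → x≈y (suc j)) (homogeneous-basis s e (f ∘ suc)))
    where open Spans (⨁ (suc n))
  ... | yes ∣e with Basis-image 0∷-hom (λ x≈y j → x≈y (suc j)) (homogeneous-basis s e (f ∘ suc))
  ... | Spans.basis {vs} ind (v⊆ , ⊆v) = basis {vectors = (monomial e∸s ∷⨁ λ _ → []) ∷ vs}
    -- Every vector of `vs` has zero head, so the coefficient of the head at `e∸s` isolates `t`.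
    ((λ t t∈ → let _ , _ , x≈ = v⊆ t∈ in
        trans (trans (sym (trans (*-congˡ (coeff-term-refl 1# e∸s)) (*-identityʳ t)))
          (sym (coeff-scalar-* t (monomial e∸s) e∸s))) (sym (at (x≈ zero) e∸s))) ∷ ind)
    ( (λ { {y} (cons {y = z} t z∈ y≈) zero b eq → let _ , _ , x≈z = v⊆ z∈ in
             trans (at (y≈ zero) b) (trans (coeff-+ (scalar t *ᵖ monomial e∸s) (z zero) b)
             (trans (0#-+ (trans (coeff-scalar-* t (monomial e∸s) b)
               (*0# t (coeff-term-≢ 1# e∸s b λ { ≡.refl → eq ∣e }))))
             (sym (at (x≈z zero) b))))
         ; {y} (cons {y = z} t z∈ y≈) (suc j) b eq → let x , x-hom , x≈z = v⊆ z∈ in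
             trans (at (y≈ (suc j)) b) (trans (coeff-+ (scalar t *ᵖ []) (z (suc j)) b)
             (trans (0#-+ refl) (trans (sym (at (x≈z (suc j)) b)) (x-hom j b eq)))) })
    , (λ {y} y-hom → cons {y = [] ∷⨁ (y ∘ suc)} (coeff (y zero) e∸s)
         (⊆v (y ∘ suc , (λ j → y-hom (suc j)) , λ j → P.refl))
         λ { zero → P.trans
               (homogeneous-multiple (λ b b≢ → y-hom zero b λ eq → b≢ (+ᵉ⇒∸ᵉ eq)))
               (P.sym (P.+-identityʳ _))
           ; (suc j) → P.sym (P.+-identityˡ (y (suc j))) }))
    where
    open Spans (⨁ (suc n))
    e∸s = Vec.zipWith ℕ._∸_ e (s (f zero))

  module _ {Q : Pred (Exponent m) 0ℓ} (Q? : Decidable Q) where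

    -- Terms are selected by their exponents, which are decidable, so no coefficient has to be
    -- tested for zero.
    sieve : Polynomial → Polynomial
    sieve = filter (Q? ∘ proj₂)

    coeff-sieve-yes : ∀ p {b} → Q b → coeff (sieve p) b ≈ coeff p b
    coeff-sieve-yes []                Qb = refl
    coeff-sieve-yes ((t , c) ∷ p) {b} Qb with Q? c
    ... | yes _  = +-congˡ (coeff-sieve-yes p Qb)
    ... | no ¬Qc = trans (coeff-sieve-yes p Qb) (sym (0#-+ (*0# t (δ-≢ b c λ { ≡.refl → ¬Qc Qb }))))

    coeff-sieve-no : ∀ p {b} → ¬ Q b → coeff (sieve p) b ≈ 0#
    coeff-sieve-no []                ¬Qb = refl
    coeff-sieve-no ((t , c) ∷ p) {b} ¬Qb with Q? c
    ... | yes Qc = trans (0#-+ (*0# t (δ-≢ b c λ { ≡.refl → ¬Qb Qc }))) (coeff-sieve-no p ¬Qb)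
    ... | no _   = coeff-sieve-no p ¬Qb

  module _ {n} (s : Fin n → Exponent m) (e : Exponent m) where
    open LeftModule (⨁ n)

    component : (Fin n → Polynomial) → Fin n → Polynomial
    component x j = sieve (λ b → s j +ᵉ b ≟ᵉ e) (x j)

    component-homogeneous : ∀ x → Homogeneous-⨁ s e (component x)
    component-homogeneous x j b = coeff-sieve-no (λ b → s j +ᵉ b ≟ᵉ e) (x j)

    component-cong : ∀ {x y} → x ≈ᴹ y → component x ≈ᴹ component y
    component-cong {x} {y} x≈y j .at b with s j +ᵉ b ≟ᵉ e
    ... | yes eq = trans (coeff-sieve-yes _ (x j) eq)
                     (trans (at (x≈y j) b) (sym (coeff-sieve-yes _ (y j) eq)))
    ... | no neq = trans (coeff-sieve-no _ (x j) neq) (sym (coeff-sieve-no _ (y j) neq))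

    component-+ : ∀ x y → component (x +ᴹ y) ≈ᴹ component x +ᴹ component y
    component-+ x y j = P.reflexive (List.filter-++ _ (x j) (y j))

    component-≡ : ∀ {x} → Homogeneous-⨁ s e x → component x ≈ᴹ x
    component-≡ {x} x-hom j .at b with s j +ᵉ b ≟ᵉ e
    ... | yes eq = coeff-sieve-yes _ (x j) eq
    ... | no neq = trans (coeff-sieve-no _ (x j) neq) (sym (x-hom j b neq))

    component-≢ : ∀ {c x} → c ≢ e → Homogeneous-⨁ s c x → component x ≈ᴹ 0ᴹ
    component-≢ {x = x} c≢e x-hom j .at b with s j +ᵉ b ≟ᵉ e
    ... | yes eq = trans (coeff-sieve-yes _ (x j) eq)
                     (x-hom j b λ eq′ → c≢e (≡.trans (≡.sym eq′) eq))
    ... | no neq = coeff-sieve-no _ (x j) neq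

  -- An element is a finite sum of single terms in single coordinates, and the term of exponent `b`
  -- in coordinate j is homogeneous of degree `s j +ᵉ b`.
  homogeneous-induction : ∀ {n q} (s : Fin n → Exponent m) (P : Pred (Fin n → Polynomial) q) →
    (∀ {x y} → ⨁._≈ᴹ_ n x y → P x → P y) → (∀ {x y} → P x → P y → P (⨁._+ᴹ_ n x y)) →
    (∀ {e x} → Homogeneous-⨁ s e x → P x) → ∀ x → P x
  -- Zero is homogeneous of every degree; `0ᵉ` is an arbitrary choice.
  homogeneous-induction {zero}  s P resp sum hom x = hom {0ᵉ} λ ()
  homogeneous-induction {suc n} s P resp sum hom x =
    resp (λ { zero → P.+-identityʳ (x zero) ; (suc j) → P.refl }) (sum (single (x zero))
      (homogeneous-induction (s ∘ suc) (P ∘ ([] ∷⨁_))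
        (λ x≈y → resp (λ { zero → P.refl ; (suc j) → x≈y j }))
        (λ Px Py → resp (λ { zero → P.refl ; (suc j) → P.refl }) (sum Px Py))
        (λ x-hom → hom (λ { zero b _ → refl ; (suc j) b neq → x-hom j b neq }))
        (x ∘ suc)))
    where
    single : ∀ p → P (p ∷⨁ λ _ → [])
    single []            = hom {0ᵉ} (λ { zero b _ → refl ; (suc j) b _ → refl })
    single ((t , b) ∷ p) = resp (λ { zero → P.refl ; (suc j) → P.refl })
      (sum {List.[ t , b ] ∷⨁ λ _ → []} (hom {s zero +ᵉ b}
        (λ { zero b′ neq → coeff-term-≢ t b b′ λ b′≡b → neq (≡.cong (s zero +ᵉ_) b′≡b)
           ; (suc j) b′ _ → refl }))
        (single p))

  module _ {n n′} {s : Fin n → Exponent m} {s′ : Fin n′ → Exponent m} {d}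
           (d-hom : LeftModuleMorphisms.IsLeftModuleHomomorphism
             (⨁.rawLeftModule n) (⨁.rawLeftModule n′) d)
           (d-graded : ∀ {e x} → Homogeneous-⨁ s e x → Homogeneous-⨁ s′ e (d x)) where
    open LeftModuleMorphisms.IsLeftModuleHomomorphism d-hom
    open LeftModule (⨁ n′)

    -- On a homogeneous element of degree `e` both sides are `d x`; on one of any other degree both
    -- are zero.
    d-component : ∀ e x → d (component s e x) ≈ᴹ component s′ e (d x)
    d-component e = homogeneous-induction s _
      (λ {x} {y} x≈y eq → ≈ᴹ-trans (⟦⟧-cong (⨁.≈ᴹ-sym n (component-cong s e {x} {y} x≈y)))
        (≈ᴹ-trans eq (component-cong s′ e {d x} {d y} (⟦⟧-cong x≈y))))
      (λ {x} {y} eqx eqy → ≈ᴹ-trans (⟦⟧-cong (component-+ s e x y)) (≈ᴹ-trans (+ᴹ-homo _ _)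
        (≈ᴹ-trans (+ᴹ-cong eqx eqy) (≈ᴹ-sym (≈ᴹ-trans
          (component-cong s′ e {d (⨁._+ᴹ_ n x y)} {d x +ᴹ d y} (+ᴹ-homo x y))
          (component-+ s′ e (d x) (d y)))))))
      homogeneous
      where
      homogeneous : ∀ {c x} → Homogeneous-⨁ s c x → d (component s e x) ≈ᴹ component s′ e (d x)
      homogeneous {c} {x} x-hom with c ≟ᵉ e
      ... | yes ≡.refl = ≈ᴹ-trans (⟦⟧-cong (component-≡ s e {x} x-hom))
        (≈ᴹ-sym (component-≡ s′ e {d x} (d-graded x-hom)))
      ... | no c≢e     = ≈ᴹ-trans (⟦⟧-cong (component-≢ s e {x = x} c≢e x-hom))
        (≈ᴹ-trans 0ᴹ-homo (≈ᴹ-sym (component-≢ s′ e {x = d x} c≢e (d-graded x-hom))))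

    -- Projecting a preimage to degree `e` leaves its image unchanged, because that image already is
    -- homogeneous of degree `e`.
    homogeneous-preimage : ∀ {e x} → Homogeneous-⨁ s′ e x → (∃[ y ] d y ≈ᴹ x) →
      ∃[ y ] Homogeneous-⨁ s e y × d y ≈ᴹ x
    homogeneous-preimage {e} {x} x-hom (y , dy≈x) = component s e y , component-homogeneous s e y ,
      ≈ᴹ-trans (d-component e y)
        (≈ᴹ-trans (component-cong s′ e {d y} dy≈x) (component-≡ s′ e {x} x-hom))

  -- The face ring in degree a.

  module _ (f : PowerFunction m) (a : Subset m) where

    -- All divisors e of v^a are treated at once, for the induction to pass through multiples.
    coeff-nonface-ideal : IsSimplicialComplex (supp f) → supp f a →
      ∀ {x} → ⟨ NonFaceMonomial (supp f) ⟩ x → ∀ b e → b +ᵉ e ≡ indicator a → coeff x e ≈ 0#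
    coeff-nonface-ideal K Ka = go
      where
      go : ∀ {x} → ⟨ NonFaceMonomial (supp f) ⟩ x → ∀ b e → b +ᵉ e ≡ indicator a → coeff x e ≈ 0#
      go (generator (τ , ¬Kτ , x≈vτ)) b e eq = trans (at x≈vτ e)
        (coeff-term-≢ 1# (indicator τ) e λ { ≡.refl →
          ¬Kτ (IsSimplicialComplex.down-closed K (indicator-⊆ b τ a eq) Ka) })
      go zero∈              b e eq = refl
      go (sum∈ {x} {y} p q) b e eq = trans (coeff-+ x y e)
        (trans (+-cong (go p b e eq) (go q b e eq)) (+-identityˡ 0#))
      go (multiple∈ r {x} p) b e eq = trans (linear-product (δ e) r x)
        (trans (linear-cong r zero-at) (linear-zero r))
        where
        -- A term v^c of `r` picks out the coefficient of `x` at `e ∸ᵉ c`, again a divisor of v^a,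
        -- now with cofactor `b +ᵉ c`. If v^c does not divide v^e, it contributes nothing.
        zero-at : ∀ c → linear (λ d → δ e (c +ᵉ d)) x ≈ 0#
        zero-at c with c +ᵉ (e ∸ᵉ c) ≟ᵉ e
        ... | yes eq′ = trans (linear-cong x (λ d → δ-shift-≡ e c d eq′))
          (go p (b +ᵉ c) (e ∸ᵉ c)
            (≡.trans (+ᵉ-assoc b c (e ∸ᵉ c)) (≡.trans (≡.cong (b +ᵉ_) eq′) eq)))
        ... | no neq  = trans (linear-cong x (λ d → δ-shift-≢ e c d neq)) (linear-zero x)
      go (resp-≈ x≈y p) b e eq = trans (sym (at x≈y e)) (go p b e eq)

    module _ {n} {s : Fin n → Exponent m} {ε}
             (ε-hom : LeftModuleMorphisms.IsLeftModuleHomomorphism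
               (⨁.rawLeftModule n) (LeftModule.rawLeftModule (restrict (faceRingᴹ (supp f)))) ε)
             (ε-graded : ∀ {e x} → Homogeneous-⨁ s e x → Homogeneous-faceRing (supp f) e (ε x))
             (ε-surjective : ∀ y → ∃[ x ] LeftModule._≈ᴹ_ (restrict (faceRingᴹ (supp f))) (ε x) y) where
      open LeftModuleMorphisms.IsLeftModuleHomomorphism ε-hom
      open LeftModule (restrict (faceRingᴹ (supp f)))
      open Spans (restrict (faceRingᴹ (supp f)))
      private
        e = indicator a

        ≈⇒≈ᴹ : ∀ {x y} → x ≈ᵖ y → x ≈ᴹ y
        ≈⇒≈ᴹ {x} {y} x≈y = congruent
          (resp-≈ (P.sym (P.trans (P.+-congʳ x≈y) (P.-‿inverseʳ y))) zero∈)

      Im : Pred Carrierᴹ _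
      Im = Image {M = ⨁ n} {N = restrict (faceRingᴹ (supp f))} ε-hom (Homogeneous-⨁ s e)

      homogeneous-image : ∀ {x} → Homogeneous-⨁ s e x → ∃[ t ] ε x ≈ᴹ t *ₗ v^ a
      homogeneous-image x-hom with q , q-hom , εx≈q ← ε-graded x-hom =
        coeff q e , ≈ᴹ-trans εx≈q (≈⇒≈ᴹ (homogeneous-multiple q-hom))

      augmentation-basis-nonface : ¬ supp f a → Basis Im 0
      augmentation-basis-nonface ¬Ka = basis []
        ( (λ { {y} (nil y≈0) → (λ _ → []) , (λ _ _ _ → refl) , ≈ᴹ-trans 0ᴹ-homo (≈ᴹ-sym y≈0) })
        , (λ (x , x-hom , εx≈y) → let t , εx≈tv = homogeneous-image x-hom in
             nil (≈ᴹ-trans (≈ᴹ-sym εx≈y) (≈ᴹ-trans εx≈tv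
               (≈ᴹ-trans (*ₗ-congˡ vᵃ≈0) (*ₗ-zeroʳ t))))))
        where
        vᵃ≈0 : v^ a ≈ᴹ 0ᴹ
        -- The difference of `v^ a` and zero unfolds to `v^ a +ᵖ []`, hence the summand `zero∈`.
        vᵃ≈0 = congruent (sum∈ (generator (a , ¬Ka , P.refl)) zero∈)

      module _ (K : IsSimplicialComplex (supp f)) (Ka : supp f a) where

        coeff-cong : ∀ {x y} → x ≈ᴹ y → coeff x e ≈ coeff y e
        coeff-cong {x} {y} (congruent x-y∈) = x∙y⁻¹≈ε⇒x≈y _ _
          (trans (+-congˡ (sym (linear-neg (δ e) y))) (trans (sym (coeff-+ x (-ᵖ y) e))
          (coeff-nonface-ideal K Ka x-y∈ 0ᵉ e (+ᵉ-identityˡ e))))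

        -- The analogue of `d-component` for the augmentation, read off through the coefficient at
        -- v^a: homogeneous elements of other degrees map to classes where this coefficient is zero.
        coeff-component : ∀ x → coeff (ε (component s e x)) e ≈ coeff (ε x) e
        coeff-component = homogeneous-induction s _
          (λ {x} {y} x≈y eq → trans
            (coeff-cong (⟦⟧-cong (⨁.≈ᴹ-sym n (component-cong s e {x} {y} x≈y))))
            (trans eq (coeff-cong (⟦⟧-cong x≈y))))
          (λ {x} {y} eqx eqy → trans
            (coeff-cong (≈ᴹ-trans (⟦⟧-cong (component-+ s e x y)) (+ᴹ-homo _ _)))
            (trans (coeff-+ (ε (component s e x)) (ε (component s e y)) e) (trans (+-cong eqx eqy)
            (sym (trans (coeff-cong (+ᴹ-homo x y)) (coeff-+ (ε x) (ε y) e))))))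
          homogeneous
          where
          homogeneous : ∀ {c x} → Homogeneous-⨁ s c x →
            coeff (ε (component s e x)) e ≈ coeff (ε x) e
          homogeneous {c} {x} x-hom with c ≟ᵉ e
          ... | yes ≡.refl = coeff-cong (⟦⟧-cong (component-≡ s e {x} x-hom))
          ... | no c≢e     with q , q-hom , εx≈q ← ε-graded x-hom =
            trans (coeff-cong (≈ᴹ-trans (⟦⟧-cong (component-≢ s e {x = x} c≢e x-hom)) 0ᴹ-homo))
                  (sym (trans (coeff-cong εx≈q) (q-hom e λ e≡c → c≢e (≡.sym e≡c))))

        coeff-multiple : ∀ t → coeff (t *ₗ v^ a) e ≈ t
        coeff-multiple t = trans (coeff-scalar-* t (v^ a) e)
          (trans (*-congˡ (coeff-term-refl 1# e)) (*-identityʳ t))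

        -- A preimage of v^a is cut down to its degree-a component, whose image is some multiple of
        -- v^a; comparing coefficients shows that the factor is 1.
        vᵃ-image : Im (v^ a)
        vᵃ-image with x , εx≈vᵃ ← ε-surjective (v^ a)
                 with t , εx′≈tvᵃ ← homogeneous-image (component-homogeneous s e x) =
          component s e x , component-homogeneous s e x ,
          ≈ᴹ-trans εx′≈tvᵃ (≈ᴹ-trans (*ₗ-congʳ t≈1) (*ₗ-identityˡ (v^ a)))
          where
          t≈1 : t ≈ 1#
          t≈1 = trans (sym (coeff-multiple t)) (trans (sym (coeff-cong εx′≈tvᵃ))
            (trans (coeff-component x) (trans (coeff-cong εx≈vᵃ) (coeff-term-refl 1# e))))

        augmentation-basis-face : Basis Im 1
        augmentation-basis-face = basis {vectors = v^ a ∷ []}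
          ((λ { t (nil tv≈0) → trans (sym (coeff-multiple t)) (coeff-cong tv≈0) }) ∷ [])
          ( (λ { {y} (cons {y = z} t (nil z≈0) y≈) → let x , x-hom , εx≈vᵃ = vᵃ-image in
               ⨁._*ₗ_ n t x ,
               (λ j b neq → trans (coeff-scalar-* t (x j) b) (*0# t (x-hom j b neq))) ,
               ≈ᴹ-trans (*ₗ-homo t x) (≈ᴹ-trans (*ₗ-congˡ {t} εx≈vᵃ) (≈ᴹ-sym
                 (≈ᴹ-trans y≈ (≈ᴹ-trans (+ᴹ-congˡ {t *ₗ v^ a} z≈0) (+ᴹ-identityʳ (t *ₗ v^ a)))))) })
          , (λ (x , x-hom , εx≈y) → let t , εx≈tv = homogeneous-image x-hom in
               cons t (nil ≈ᴹ-refl) (≈ᴹ-trans (≈ᴹ-sym εx≈y)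
                 (≈ᴹ-trans εx≈tv (≈ᴹ-sym (+ᴹ-identityʳ (t *ₗ v^ a)))))))

      -- Whether `a` is a face is decided by the parity `f a`, so this basis is obtained without
      -- double negation.
      augmentation-basis : IsSimplicialComplex (supp f) →
        ∃[ l ] Basis Im l × parity l ≡ f a
      augmentation-basis K = go (f a) ≡.refl
        where
        go : ∀ p → f a ≡ p → ∃[ l ] Basis Im l × parity l ≡ p
        go 1ℙ fa = 1 , augmentation-basis-face K fa , ≡.refl
        go 0ℙ fa = 0 , augmentation-basis-nonface
          (λ Ka → contradiction (≡.trans (≡.sym fa) Ka) λ ()) , ≡.refl

-- The Euler characteristic of a strand modulo 2.

module EulerCharacteristic {c ℓ₁ ℓ₂} (k : HeytingField c ℓ₁ ℓ₂) (m : ℕ)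
         (f : PowerFunction m) (K : Nice f) (R : MinimalFreeResolution k m (supp f)) (a : Subset m) where
  open MinimalFreeResolution R
  open FaceRings k m using (Homogeneous-⨁; faceRingᴹ)
  open LinearAlgebra k
  open Graded k m

  private
    e = indicator a

    kK : LeftModule kring _ _
    kK = restrict (faceRingᴹ (supp f))

  dim : ℕ → ℕ
  dim i = length (filter (λ j → shift i j ∣ᵉ? e) (allFin (rank i)))

  Boundary : ∀ i → Pred (F.Carrierᴹ i) _
  Boundary i x = Homogeneous-⨁ (shift i) e x × ∃[ y ] F._≈ᴹ_ i (d i y) x

  -- The strand truncated at F i has a single homology, the image of d i, of dimension r.
  PartialEuler : ℕ → Set _
  PartialEuler i = ∃[ r ] Spans.Basis (⨁ (rank i)) (Boundary i) r ×
    parity (sum (map dim (upTo (suc i)))) ≡ f a +ℙ parity r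

  -- Rank-nullity splits the strand of `F i` into kernel and image. Exactness identifies the kernel
  -- with `Boundary i`, and the image is the preceding boundary, or for i = 0 the degree-a part of
  -- the face ring.
  partial-Euler : ∀ i → DoubleNegation (PartialEuler i)
  partial-Euler zero = ¬¬-map step
    (rank-nullity {M = ⨁ (rank 0)} {N = kK} ε-hom′ (homogeneous-basis (shift 0) e id))
    where
    ε-hom′ = restrict-hom {M = F 0} {N = faceRingᴹ (supp f)} ε-hom
    step : _ → PartialEuler 0
    step (r , s , ker , im , r+s≡) =
      let l , aug , l≡f = augmentation-basis f a {s = shift 0} ε-hom′ ε-graded
            (λ y → let x , εx≈y = ε-surjective y in x , εx≈y (F.≈ᴹ-refl 0)) K
          s≡l = Spans.Basis-unique kK im aug (id , id)
      in r ,
      Spans.Basis-resp (⨁ (rank 0))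
        ( (λ {x} (x-hom , εx≈0) → x-hom , Equivalence.to (exact-0 x) εx≈0)
        , (λ {x} (x-hom , x∈) → x-hom , Equivalence.from (exact-0 x) x∈)) ker ,
      (begin
        parity (dim 0 ℕ.+ 0)     ≡⟨ ≡.cong parity (ℕ.+-identityʳ (dim 0)) ⟩
        parity (dim 0)           ≡⟨ ≡.cong parity (≡.trans (≡.sym r+s≡) (ℕ.+-comm r s)) ⟩
        parity (s ℕ.+ r)         ≡⟨ +-homo-+ s r ⟩
        parity s +ℙ parity r     ≡⟨ ≡.cong (_+ℙ parity r) (≡.trans (≡.cong parity s≡l) l≡f) ⟩
        f a +ℙ parity r          ∎)
      where open ≡.≡-Reasoning
  partial-Euler (suc i) = partial-Euler i >>= λ (s′ , bd , Σ≡) → ¬¬-map (step s′ bd Σ≡)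
    (rank-nullity {M = ⨁ (rank (suc i))} {N = ⨁ (rank i)} d-homᵢ
      (homogeneous-basis (shift (suc i)) e id))
    where
    d-homᵢ = restrict-hom {M = F (suc i)} {N = F i} (d-hom i)
    step : ∀ s′ → Spans.Basis (⨁ (rank i)) (Boundary i) s′ →
      parity (sum (map dim (upTo (suc i)))) ≡ f a +ℙ parity s′ → _ → PartialEuler (suc i)
    step s′ bd Σ≡ (r , s , ker , im , r+s≡) =
      let s≡s′ = Spans.Basis-unique (⨁ (rank i)) im bd
            ( (λ (x , x-hom , dx≈y) → (λ j b neq → HeytingField.trans k
                (HeytingField.sym k (Polynomials.at (dx≈y j) b)) (d-graded i x-hom j b neq)) , x , dx≈y)
            , (λ {y} (y-hom , y∈) →
                homogeneous-preimage {s = shift (suc i)} {s′ = shift i} d-homᵢ (d-graded i) y-hom y∈))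
      in r ,
      Spans.Basis-resp (⨁ (rank (suc i)))
        ( (λ {x} (x-hom , dx≈0) → x-hom , Equivalence.to (exact-suc i x) dx≈0)
        , (λ {x} (x-hom , x∈) → x-hom , Equivalence.from (exact-suc i x) x∈)) ker ,
      (begin
        parity (sum (map dim (upTo (suc (suc i)))))
          ≡⟨ ≡.cong (parity ∘ sum ∘ map dim) (List.upTo-∷ʳ (suc i)) ⟨
        parity (sum (map dim (upTo (suc i) List.∷ʳ suc i)))
          ≡⟨ ≡.cong (parity ∘ sum) (List.map-++ dim (upTo (suc i)) List.[ suc i ]) ⟩
        parity (sum (map dim (upTo (suc i)) List.∷ʳ dim (suc i)))
          ≡⟨ ≡.cong parity (sum-++ (map dim (upTo (suc i))) _) ⟩
        parity (sum (map dim (upTo (suc i))) ℕ.+ (dim (suc i) ℕ.+ 0))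
          ≡⟨ +-homo-+ (sum (map dim (upTo (suc i)))) _ ⟩
        parity (sum (map dim (upTo (suc i)))) +ℙ parity (dim (suc i) ℕ.+ 0)
          ≡⟨ ≡.cong₂ _+ℙ_ Σ≡ (≡.cong parity (≡.trans (ℕ.+-identityʳ _) (≡.trans (≡.sym r+s≡)
               (≡.trans (ℕ.+-comm r s) (≡.cong (ℕ._+ r) s≡s′))))) ⟩
        (f a +ℙ parity s′) +ℙ parity (s′ ℕ.+ r)
          ≡⟨ ≡.cong ((f a +ℙ parity s′) +ℙ_) (+-homo-+ s′ r) ⟩
        (f a +ℙ parity s′) +ℙ (parity s′ +ℙ parity r)
          -- The rank of `d i` occurs twice, as the homology left by the shorter truncation and as a
          -- part of the new dimension.
          ≡⟨ cancel (f a) (parity s′) (parity r) ⟩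
        f a +ℙ parity r ∎)
      where
      open ≡.≡-Reasoning
      cancel : ∀ p q r → (p +ℙ q) +ℙ (q +ℙ r) ≡ p +ℙ r
      cancel p q r = ≡.trans (Parity.+-assoc p q (q +ℙ r)) (≡.cong (p +ℙ_)
        (≡.trans (≡.sym (Parity.+-assoc q q r)) (≡.cong (_+ℙ r) (Parity.p+p≡0ℙ q))))

  -- At the end of the resolution nothing is left over: `F (suc h)` has rank 0, so the image of
  -- `d h` is zero.
  Euler-characteristic : parity (sum (map dim (upTo (suc h)))) ≡ f a
  Euler-characteristic = decidable-stable (_ Parity.≟ _) (¬¬-map finish (partial-Euler h))
    where
    open Spans (⨁ (rank h))
    open ModuleMorphisms.IsModuleHomomorphism (d-hom h)
    F-suc-h-trivial : ∀ y → F._≈ᴹ_ (suc h) y (F.0ᴹ (suc h))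
    F-suc-h-trivial y j with () ← ≡.subst Fin (rank->h ℕ.≤-refl) j

    finish : PartialEuler h → parity (sum (map dim (upTo (suc h)))) ≡ f a
    finish (r , bd , Σ≡) = ≡.trans Σ≡
      (≡.trans (≡.cong (λ r → f a +ℙ parity r) r≡0) (Parity.+-identityʳ (f a)))
      where
      0-basis : Basis (λ x → F._≈ᴹ_ h x (F.0ᴹ h)) 0
      0-basis = basis [] ((λ { (nil x≈0) → x≈0 }) , nil)

      r≡0 : r ≡ 0
      r≡0 = Basis-unique bd 0-basis
        ( (λ (_ , y , dy≈x) → F.≈ᴹ-trans h (F.≈ᴹ-sym h dy≈x)
             (F.≈ᴹ-trans h (⟦⟧-cong (F-suc-h-trivial y)) 0ᴹ-homo))
        , (λ x≈0 → (λ j b _ → Polynomials.at (x≈0 j) b) , F.0ᴹ (suc h) ,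
             F.≈ᴹ-trans h 0ᴹ-homo (F.≈ᴹ-sym h x≈0)))

-- From parities to the bound by Betti numbers.

corollary3p2 : ∀ {c ℓ₁ ℓ₂ : Level} (k : HeytingField c ℓ₁ ℓ₂) (m : ℕ) .{{_ : NonZero m}}
    (f : PowerFunction m) → Nice f → IsOnVertexSet[m] (supp f) →
    (R : MinimalFreeResolution k m (supp f)) →
    let open MinimalFreeResolution R in
    ∣supp Möbius f ∣ ≤
    sum (map (λ i → sum (map (λ a → β[ i , a ]) (subsets m))) (upTo (suc h)))
corollary3p2 k m f K _ R = ℕ.≤-trans
  (count-odd≤sum (Möbius f) total Möbius-f≡total (subsets m))
  -- Parities are compared subset by subset, so the sum over subsets has to be the outer one there.
  (ℕ.≤-reflexive (≡.sym (sum-map-swap (λ i a → β[ i , a ]) (upTo (suc h)) (subsets m))))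
  where
  open MinimalFreeResolution R
  total : Subset m → ℕ
  total a = sum (map (λ i → β[ i , a ]) (upTo (suc h)))

  Möbius-total≡f : ∀ a → Möbius (parity ∘ total) a ≡ f a
  Möbius-total≡f a = ≡.trans
    (Möbius-sum {g = β[_,_]} {h = λ i a → EulerCharacteristic.dim k m f K R a i}
      (λ i → Möbius-degrees (shift i) (allFin (rank i))) (upTo (suc h)) a)
    (EulerCharacteristic.Euler-characteristic k m f K R a)

  Möbius-f≡total : ∀ a → Möbius f a ≡ parity (total a)
  Möbius-f≡total a = ≡.trans (Möbius-cong (λ b → ≡.sym (Möbius-total≡f b)) a)
    (Möbius-involutive (parity ∘ total) a)
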